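{- Let $H$ be a graph, let $L(H)$ be its line graph, let $\mathfrak{C}$ be a Kempe coloring of $L(H)$, and let $T$ be a transversal of $\mathfrak{C}$. Then there exists a complete minor (clique minor) in $L(H)$ that is traversed by $T$.
   Context: All graphs are finite, undirected and loopless; they may contain parallel edges (graphs without parallel edges are called simple). The line graph $L(H)$ of a graph $H$ is the simple graph with vertex set $E(H)$ in which two distinct vertices are adjacent if and only if they are incident as edges of $H$, i.e. they share at least one endvertex in $H$ (so parallel edges of $H$ are adjacent in $L(H)$). Let $G$ be a graph. A set $A \subseteq V(G)$ is connected if the subgraph $G[A]$ induced by $A$ is connected. Disjoint sets $A,B \subseteq V(G)$ are adjacent if some vertex of $A$ is adjacent to some vertex of $B$. A clique minor (also: complete minor) of $G$ is a set of connected, nonempty, pairwise disjoint, pairwise adjacent subsets of $V(G)$, called the branching sets. An anticlique of $G$ is a set of pairwise nonadjacent vertices. A coloring of $G$ is a partition of $V(G)$ into anticliques (the color classes). A Kempe coloring of $G$ is a coloring such that the union of any two (distinct) color classes induces a connected subgraph of $G$. A transversal of a set $\mathfrak{S}$ of pairwise disjoint sets is a set $T \subseteq \bigcup \mathfrak{S}$ such that $|T \cap A| = 1$ for all $A \in \mathfrak{S}$; in this case one also says that $\mathfrak{S}$ is traversed by $T$. (In particular, a clique minor traversed by $T$ has exactly $|T|$ branching sets, each containing exactly one element of $T$, and every element of $T$ lies in a branching set.) -}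

module Defs where

open import Level using (0ℓ)
open import Data.Nat.Base using (ℕ)
open import Data.Fin.Base using (Fin)
open import Data.Fin.Properties using (_≟_; any?)
open import Data.Fin.Subset
  using (Subset; _∈_; _⊆_; _∩_; _∪_; ⋃; ∣_∣; Nonempty; Empty)
open import Data.List.Base using (List)
open import Data.List.Relation.Unary.All using (All)
import Data.List.Membership.Propositional as List
open import Data.Product.Base using (_×_; _,_; proj₁; proj₂; ∃-syntax)
open import Data.Sum.Base using (_⊎_)
open import Relation.Binary.Core using (Rel)
open import Relation.Binary.Definitions using (Symmetric; Irreflexive; Decidable)
open import Relation.Binary.Construct.Closure.ReflexiveTransitive using (Star)
open import Relation.Binary.PropositionalEquality.Core using (_≡_; _≢_; sym)
open import Relation.Nullary.Decidable using (_×-dec_; _⊎-dec_; ¬?)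
open import Relation.Nullary.Negation.Core using (¬_)

-- Finite loopless multigraphs.  The order of the two components of `ends e`
-- carries no meaning: only `_isEndOf_` is used below.
record Graph : Set where
  field
    order    : ℕ
    size     : ℕ
    ends     : Fin size → Fin order × Fin order
    loopless : ∀ e → proj₁ (ends e) ≢ proj₂ (ends e)

  _isEndOf_ : Fin order → Fin size → Set
  v isEndOf e = v ≡ proj₁ (ends e) ⊎ v ≡ proj₂ (ends e)

  _isEndOf?_ : Decidable _isEndOf_
  v isEndOf? e = (v ≟ proj₁ (ends e)) ⊎-dec (v ≟ proj₂ (ends e))

record SimpleGraph (n : ℕ) : Set₁ where
  field
    Adj    : Rel (Fin n) 0ℓ
    symm   : Symmetric Adj
    irrefl : Irreflexive _≡_ Adj
    adj?   : Decidable Adj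

L : (H : Graph) → SimpleGraph (Graph.size H)
L H = record
  { Adj    = λ e f → e ≢ f × ∃[ v ] (v isEndOf e × v isEndOf f)
  ; symm   = λ (e≢f , v , p , q) → (λ f≡e → e≢f (sym f≡e)) , v , q , p
  ; irrefl = λ e≡f (e≢f , _) → e≢f e≡f
  ; adj?   = λ e f → ¬? (e ≟ f) ×-dec any? (λ v → (v isEndOf? e) ×-dec (v isEndOf? f))
  }
  where open Graph H

-- A finite set of subsets is given by a list of its members; order and
-- repetitions are irrelevant, since families are only accessed through
-- membership, and "pairwise" refers to members that differ as sets.
Family : ℕ → Set
Family n = List (Subset n)

Pairwise : ∀ {n} → (Subset n → Subset n → Set) → Family n → Set
Pairwise R 𝔖 = ∀ {A B} → A List.∈ 𝔖 → B List.∈ 𝔖 → A ≢ B → R A B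

Disjoint : ∀ {n} → Subset n → Subset n → Set
Disjoint A B = Empty (A ∩ B)

-- To be used only for families of pairwise disjoint sets.
record IsTransversal {n} (T : Subset n) (𝔖 : Family n) : Set where
  field
    inUnion : T ⊆ ⋃ 𝔖
    meets   : All (λ A → ∣ T ∩ A ∣ ≡ 1) 𝔖

record IsPartition {n} (𝔖 : Family n) : Set where
  field
    nonempty : All Nonempty 𝔖
    disjoint : Pairwise Disjoint 𝔖
    covers   : ∀ v → v ∈ ⋃ 𝔖

module _ {n} (G : SimpleGraph n) where
  open SimpleGraph G

  -- The edges of the induced subgraph G[A].
  InducedAdj : Subset n → Rel (Fin n) 0ℓ
  InducedAdj A u v = u ∈ A × v ∈ A × Adj u v

  -- Any two vertices of G[A] are joined by a walk in G[A].
  Connected : Subset n → Set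
  Connected A = ∀ {u v} → u ∈ A → v ∈ A → Star (InducedAdj A) u v

  Adjacent : Subset n → Subset n → Set
  Adjacent A B = ∃[ a ] ∃[ b ] (a ∈ A × b ∈ B × Adj a b)

  Anticlique : Subset n → Set
  Anticlique A = ∀ {u v} → u ∈ A → v ∈ A → ¬ Adj u v

  record IsCliqueMinor (𝔎 : Family n) : Set where
    field
      connected : All Connected 𝔎
      nonempty  : All Nonempty 𝔎
      disjoint  : Pairwise Disjoint 𝔎
      adjacent  : Pairwise Adjacent 𝔎

  record IsColoring (ℭ : Family n) : Set where
    field
      isPartition : IsPartition ℭ
      anticliques : All Anticlique ℭ

  record IsKempeColoring (ℭ : Family n) : Set where
    field
      isColoring : IsColoring ℭ
      kempe      : Pairwise (λ A B → Connected (A ∪ B)) ℭ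

{-# OPTIONS --safe #-}
-- Colour each edge e of H by the element col e of T in its colour class. Two colour classes form
-- a path or a cycle.
--
-- Suppose that some vertex v is incident with all colours. If the edges of T can be linked in
-- L(H) to the edges at v by disjoint paths, these paths are the branching sets. Otherwise Menger
-- gives a separating set S of fewer than |T| edges; as any two colours connect T to v, S has
-- exactly one edge of each colour but one. Contract the side of v to a single vertex: the result
-- is again Kempe coloured and smaller, and a rooted minor of it lifts, because S is linked to the
-- edges at v on the contracted side.
--
-- Suppose that no vertex is incident with all colours and that T is not a clique. Then H has no
-- parallel edges, and for any two colours, zero or two vertices are incident with exactly one of
-- them. These pairs form a sunflower, so there are a vertex set W and distinct vertices y t such
-- that the vertices of colour t are W Δ {y t}. A count of neighbours shows that H is complete on W
-- and that every y t is in W.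
--
-- In a complete graph choose distinct centres κ t for the t in T, as many as possible being an end
-- of their t. For t ≢ u the edge joining κ t to κ u is given to t or to u, unless it is in T.
-- The few pairs for which it is in T are joined through another vertex.
module Submission where

open import Defs
open import Level using (0ℓ)
open import Data.Bool.Base using (Bool; true; false; not)
import Data.Bool.Properties as Bool
open import Data.Empty using (⊥; ⊥-elim)
open import Data.Fin.Base as Fin using (Fin; zero; suc; toℕ)
open import Data.Fin.Permutation.Components using (transpose; transpose-inverse)
open import Data.Fin.Properties as Fin using (_≟_; any?; all?; pigeonhole; toℕ≤n)
open import Data.Fin.Subset
  using (Subset; inside; outside; ⊤; _∈_; _∉_; _⊆_; _∩_; _∪_; _─_; _-_; ⁅_⁆; ⋃; ∣_∣; Nonempty)
open import Data.Fin.Subset.Properties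
open import Data.List.Base using (List; []; _∷_; map; filter; allFin)
import Data.List.Membership.Propositional as List
open import Data.List.Membership.Propositional.Properties
  using (∈-filter⁺; ∈-filter⁻; ∈-allFin; ∈-map⁺; ∈-map⁻)
import Data.List.Relation.Unary.All as All
open import Data.List.Relation.Unary.AllPairs using (_∷_)
open import Data.List.Relation.Unary.Any as Any using (here; there)
open import Data.List.Relation.Unary.Unique.Propositional using (Unique)
import Data.List.Relation.Unary.Unique.Propositional.Properties as Unique
open import Data.Nat.Base using (ℕ; zero; suc; _+_; _≤_; _<_; z≤n; s≤s)
import Data.Nat.Properties as ℕ
open import Data.Product.Base using (_×_; _,_; proj₁; proj₂; ∃-syntax)
open import Data.Sum.Base using (_⊎_; inj₁; inj₂; [_,_]′)
open import Data.Vec.Base using ([]; _∷_; here; there)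
import Data.Vec.Properties as Vec
open import Function.Base using (_∘_; id; flip; case_of_)
open import Relation.Binary.Construct.Closure.ReflexiveTransitive using (Star; ε; _◅_; _◅◅_; gmap)
open import Relation.Binary.Core using (Rel)
open import Relation.Binary.Definitions using (Symmetric; Decidable)
open import Relation.Binary.PropositionalEquality
  using (_≡_; _≢_; refl; sym; trans; cong; subst)
open import Relation.Nullary.Decidable
  using (Dec; yes; no; does; dec-true; _×-dec_; _⊎-dec_; _→-dec_; ¬?; decidable-stable)
open import Relation.Nullary.Negation.Core using (¬_; contradiction)
open import Relation.Unary using (Pred) renaming (Decidable to Decidable₁)

-- Counting in finite subsets

sieve : ∀ {n} {P : Pred (Fin n) 0ℓ} → Decidable₁ P → Subset n
sieve {zero}  P? = []
sieve {suc n} P? = does (P? zero) ∷ sieve (P? ∘ suc)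

sieve⁺ : ∀ {n} {P : Pred (Fin n) 0ℓ} (P? : Decidable₁ P) {x} → P x → x ∈ sieve P?
sieve⁺ P? {zero} px with P? zero
... | yes _  = here
... | no ¬px = contradiction px ¬px
sieve⁺ P? {suc x} px = there (sieve⁺ (P? ∘ suc) px)

sieve⁻ : ∀ {n} {P : Pred (Fin n) 0ℓ} (P? : Decidable₁ P) {x} → x ∈ sieve P? → P x
sieve⁻ P? {zero} x∈ with P? zero | x∈
... | yes px | here = px
sieve⁻ P? {suc x} (there x∈) = sieve⁻ (P? ∘ suc) x∈

x∈p─q⁻ : ∀ {n} (p q : Subset n) {x} → x ∈ p ─ q → x ∈ p × x ∉ q
x∈p─q⁻ (inside ∷ p) (outside ∷ q) {zero} here = here , λ ()
x∈p─q⁻ (outside ∷ p) (inside ∷ q) {zero} ()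
x∈p─q⁻ (outside ∷ p) (outside ∷ q) {zero} ()
x∈p─q⁻ (_ ∷ p) (_ ∷ q) {suc x} (there x∈) with x∈p─q⁻ p q x∈
... | x∈p , x∉q = there x∈p , λ { (there x∈q) → x∉q x∈q }

x∈p-y⁻ : ∀ {n} (p : Subset n) y {x} → x ∈ p - y → x ∈ p × x ≢ y
x∈p-y⁻ p y x∈ with x∈p─q⁻ p ⁅ y ⁆ x∈
... | x∈p , x∉y = x∈p , x∉⁅y⁆⇒x≢y x∉y

+-sucʳ-≤ : ∀ {r p q} → r ≤ suc (p + q) → r ≤ p + suc q
+-sucʳ-≤ {r} {p} {q} = subst (r ≤_) (sym (ℕ.+-suc p q))

r⊆p∪q⇒∣r∣≤∣p∣+∣q∣ : ∀ {n} (r p q : Subset n) →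
  (∀ {x} → x ∈ r → x ∈ p ⊎ x ∈ q) → ∣ r ∣ ≤ ∣ p ∣ + ∣ q ∣
r⊆p∪q⇒∣r∣≤∣p∣+∣q∣ [] [] [] _ = z≤n
r⊆p∪q⇒∣r∣≤∣p∣+∣q∣ (c ∷ r) (a ∷ p) (b ∷ q) h
  with r⊆p∪q⇒∣r∣≤∣p∣+∣q∣ r p q (λ x∈r → [ (λ { (there y) → inj₁ y }) , (λ { (there y) → inj₂ y }) ]′ (h (there x∈r)))
... | ih with c | a | b
...   | outside | outside | outside = ih
...   | outside | outside | inside  = +-sucʳ-≤ (ℕ.m≤n⇒m≤1+n ih)
...   | outside | inside  | outside = ℕ.m≤n⇒m≤1+n ih
...   | outside | inside  | inside  =
        ℕ.m≤n⇒m≤1+n (+-sucʳ-≤ (ℕ.m≤n⇒m≤1+n ih))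
...   | inside  | outside | outside = case h here of λ { (inj₁ ()) ; (inj₂ ()) }
...   | inside  | outside | inside  = +-sucʳ-≤ (s≤s ih)
...   | inside  | inside  | outside = s≤s ih
...   | inside  | inside  | inside  =
        s≤s (+-sucʳ-≤ (ℕ.m≤n⇒m≤1+n ih))

disjoint⇒∣p∣+∣q∣≤∣r∣ : ∀ {n} (p q r : Subset n) → p ⊆ r → q ⊆ r →
  (∀ {x} → x ∈ p → x ∉ q) → ∣ p ∣ + ∣ q ∣ ≤ ∣ r ∣
disjoint⇒∣p∣+∣q∣≤∣r∣ [] [] [] _ _ _ = z≤n
disjoint⇒∣p∣+∣q∣≤∣r∣ (a ∷ p) (b ∷ q) (c ∷ r) p⊆r q⊆r p#q
  with disjoint⇒∣p∣+∣q∣≤∣r∣ p q r (drop-∷-⊆ p⊆r) (drop-∷-⊆ q⊆r) (λ x y → p#q (there x) (there y))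
... | ih with a | b | c
...   | outside | outside | outside = ih
...   | outside | outside | inside  = ℕ.m≤n⇒m≤1+n ih
...   | inside  | outside | inside  = s≤s ih
...   | outside | inside  | inside  = subst (_≤ suc ∣ r ∣) (sym (ℕ.+-suc ∣ p ∣ ∣ q ∣)) (s≤s ih)
...   | inside  | inside  | _       = contradiction here (p#q here)
...   | inside  | outside | outside = case p⊆r here of λ ()
...   | outside | inside  | outside = case q⊆r here of λ ()

injection⇒∣p∣≤∣q∣ : ∀ {m n} (p : Subset m) (q : Subset n) (f : Fin m → Fin n) →
  (∀ {x} → x ∈ p → f x ∈ q) → (∀ {x y} → x ∈ p → y ∈ p → f x ≡ f y → x ≡ y) →
  ∣ p ∣ ≤ ∣ q ∣
injection⇒∣p∣≤∣q∣ [] q f _ _ = z≤n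
injection⇒∣p∣≤∣q∣ (outside ∷ p) q f into inj =
  injection⇒∣p∣≤∣q∣ p q (f ∘ suc) (into ∘ there)
    (λ x y eq → case inj (there x) (there y) eq of λ { refl → refl })
injection⇒∣p∣≤∣q∣ (inside ∷ p) q f into inj =
  ℕ.≤-trans (s≤s (injection⇒∣p∣≤∣q∣ p (q - f zero) (f ∘ suc)
      (λ x∈p → x∈p∧x≢y⇒x∈p-y (into (there x∈p)) (λ eq → case inj (there x∈p) here eq of λ ()))
      (λ x y eq → case inj (there x) (there y) eq of λ { refl → refl })))
    (x∈p⇒∣p-x∣<∣p∣ (into here))

∣p∣≤1+∣p-x∣ : ∀ {n} (p : Subset n) x → ∣ p ∣ ≤ suc ∣ p - x ∣
∣p∣≤1+∣p-x∣ p x = subst (λ k → ∣ p ∣ ≤ k + ∣ p - x ∣) (∣⁅x⁆∣≡1 x)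
  (r⊆p∪q⇒∣r∣≤∣p∣+∣q∣ p ⁅ x ⁆ (p - x) λ {y} y∈p → split y∈p (y ≟ x))
  where
  split : ∀ {y} → y ∈ p → Dec (y ≡ x) → y ∈ ⁅ x ⁆ ⊎ y ∈ p - x
  split y∈p (yes refl) = inj₁ (x∈⁅x⁆ x)
  split y∈p (no y≢x)   = inj₂ (x∈p∧x≢y⇒x∈p-y y∈p y≢x)

-- If every element of `q` had a preimage in `p`, choosing one for each would inject `q` into `p`.
missed : ∀ {n} (p q : Subset n) (f : Fin n → Fin n) → ∣ p ∣ < ∣ q ∣ →
  ∃[ t ] (t ∈ q × (∀ {s} → s ∈ p → f s ≢ t))
missed {n} p q f p<q with any? (λ t → (t ∈? q) ×-dec ¬? (any? λ s → (s ∈? p) ×-dec (f s ≟ t)))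
... | yes (t , t∈q , ¬hit) = t , t∈q , λ s∈p eq → ¬hit (_ , s∈p , eq)
... | no ¬miss = contradiction (injection⇒∣p∣≤∣q∣ q p section into inj) (ℕ.<⇒≱ p<q)
  where
  hit? : ∀ t → Dec (∃[ s ] (s ∈ p × f s ≡ t))
  hit? t = any? λ s → (s ∈? p) ×-dec (f s ≟ t)

  section : Fin n → Fin n
  section t with hit? t
  ... | yes (s , _) = s
  ... | no _        = t

  spec : ∀ {t} → t ∈ q → section t ∈ p × f (section t) ≡ t
  spec {t} t∈q with hit? t
  ... | yes (s , s∈p , eq) = s∈p , eq
  ... | no ¬hit = contradiction (t , t∈q , ¬hit) ¬miss

  into : ∀ {t} → t ∈ q → section t ∈ p
  into = proj₁ ∘ spec

  inj : ∀ {t u} → t ∈ q → u ∈ q → section t ≡ section u → t ≡ u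
  inj t∈q u∈q eq = trans (sym (proj₂ (spec t∈q))) (trans (cong f eq) (proj₂ (spec u∈q)))

-- Hall's theorem

module Hall {n} {R : Rel (Fin n) 0ℓ} (R? : Decidable R) where

  Neighbour : Subset n → Subset n → Pred (Fin n) 0ℓ
  Neighbour B U w = w ∈ B × ∃[ u ] (u ∈ U × R u w)

  Neighbour? : ∀ B U → Decidable₁ (Neighbour B U)
  Neighbour? B U w = (w ∈? B) ×-dec any? λ u → (u ∈? U) ×-dec R? u w

  neighbours : Subset n → Subset n → Subset n
  neighbours B U = sieve (Neighbour? B U)

  record Matching (A B : Subset n) : Set where
    field
      mate      : Fin n → Fin n
      into      : ∀ {u} → u ∈ A → mate u ∈ B
      related   : ∀ {u} → u ∈ A → R u (mate u)
      injective : ∀ {u v} → u ∈ A → v ∈ A → mate u ≡ mate v → u ≡ v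

  HallCondition : Subset n → Subset n → Set
  HallCondition A B = ∀ U → U ⊆ A → ∣ U ∣ ≤ ∣ neighbours B U ∣

  Tight : Subset n → Subset n → Subset n → Set
  Tight A B U = U ⊆ A × Nonempty U × ∣ U ∣ < ∣ A ∣ × ∣ neighbours B U ∣ ≤ ∣ U ∣

  Tight? : ∀ A B → Decidable₁ (Tight A B)
  Tight? A B U = (U ⊆? A) ×-dec nonempty? U ×-dec (∣ U ∣ ℕ.<? ∣ A ∣) ×-dec (∣ neighbours B U ∣ ℕ.≤? ∣ U ∣)

  open Matching

  glue : ∀ {A B U V B₁ B₂} → (∀ {u} → u ∈ A → u ∈ U ⊎ u ∈ V) →
    (∀ {u} → u ∈ B₁ → u ∉ B₂) → B₁ ⊆ B → B₂ ⊆ B →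
    Matching U B₁ → Matching V B₂ → Matching A B
  glue {A} {B} {U} {V} {B₁} {B₂} split B₁#B₂ B₁⊆B B₂⊆B M₁ M₂ = record
    { mate = f ; into = intoB ; related = rel ; injective = inj }
    where
    f : Fin n → Fin n
    f u with u ∈? U
    ... | yes _ = mate M₁ u
    ... | no _  = mate M₂ u

    inV : ∀ {u} → u ∈ A → u ∉ U → u ∈ V
    inV u∈A u∉U = [ (λ u∈U → contradiction u∈U u∉U) , id ]′ (split u∈A)

    intoB : ∀ {u} → u ∈ A → f u ∈ B
    intoB {u} u∈A with u ∈? U
    ... | yes u∈U = B₁⊆B (into M₁ u∈U)
    ... | no u∉U  = B₂⊆B (into M₂ (inV u∈A u∉U))

    rel : ∀ {u} → u ∈ A → R u (f u)
    rel {u} u∈A with u ∈? U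
    ... | yes u∈U = related M₁ u∈U
    ... | no u∉U  = related M₂ (inV u∈A u∉U)

    inj : ∀ {u v} → u ∈ A → v ∈ A → f u ≡ f v → u ≡ v
    inj {u} {v} u∈A v∈A eq with u ∈? U | v ∈? U
    ... | yes u∈U | yes v∈U = injective M₁ u∈U v∈U eq
    ... | yes u∈U | no v∉U  =
      contradiction (into M₂ (inV v∈A v∉U)) (B₁#B₂ (subst (_∈ B₁) eq (into M₁ u∈U)))
    ... | no u∉U  | yes v∈U =
      contradiction (into M₂ (inV u∈A u∉U)) (B₁#B₂ (subst (_∈ B₁) (sym eq) (into M₁ v∈U)))
    ... | no u∉U  | no v∉U  = injective M₂ (inV u∈A u∉U) (inV v∈A v∉U) eq

  -- Halmos and Vaughan: split along a proper tight set, or, if there is none, match one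
  -- element arbitrarily.
  hall : ∀ k A B → ∣ A ∣ ≤ k → HallCondition A B → Matching A B
  hall k A B A≤k cond with nonempty? A
  ... | no empty = record
    { mate = id ; into = absurd ; related = absurd ; injective = λ u∈A → absurd u∈A }
    where
    absurd : ∀ {ℓ} {C : Set ℓ} {u} → u ∈ A → C
    absurd u∈A = contradiction (_ , u∈A) empty
  hall zero A B A≤0 cond | yes (a , a∈A) =
    contradiction (ℕ.≤-trans (ℕ.≤-trans (s≤s z≤n) (x∈p⇒∣p-x∣<∣p∣ a∈A)) A≤0) λ ()
  hall (suc k) A B A≤k cond | yes (a , a∈A) with anySubset? (Tight? A B)
  ... | yes (U , U⊆A , (u₀ , u₀∈U) , U<A , N≤U) = glue split disjoint N⊆B (p─q⊆p B N)
          (hall k U N (ℕ.≤-pred (ℕ.<-≤-trans U<A A≤k)) condU)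
          (hall k (A ─ U) (B ─ N)
            (ℕ.≤-pred (ℕ.<-≤-trans (p∩q≢∅⇒∣p─q∣<∣p∣ A U (u₀ , x∈p∩q⁺ (U⊆A u₀∈U , u₀∈U))) A≤k)) condV)
    where
    N : Subset n
    N = neighbours B U

    N⊆B : N ⊆ B
    N⊆B = proj₁ ∘ sieve⁻ (Neighbour? B U)

    split : ∀ {u} → u ∈ A → u ∈ U ⊎ u ∈ A ─ U
    split {u} u∈A with u ∈? U
    ... | yes u∈U = inj₁ u∈U
    ... | no u∉U  = inj₂ (x∈p∧x∉q⇒x∈p─q u∈A u∉U)

    disjoint : ∀ {u} → u ∈ N → u ∉ B ─ N
    disjoint u∈N u∈ = proj₂ (x∈p─q⁻ B N u∈) u∈N

    condU : HallCondition U N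
    condU V V⊆U = ℕ.≤-trans (cond V (U⊆A ∘ V⊆U)) (p⊆q⇒∣p∣≤∣q∣ λ w∈ →
      case sieve⁻ (Neighbour? B V) w∈ of λ (w∈B , u , u∈V , r) →
        sieve⁺ (Neighbour? N V) (sieve⁺ (Neighbour? B U) (w∈B , u , V⊆U u∈V , r) , u , u∈V , r))

    -- Apply `cond` to `U ∪ V`: its neighbours lie in `N` or are neighbours of `V` outside `N`, and
    -- `N` is at most as large as `U`, so `∣ U ∣` cancels.
    condV : HallCondition (A ─ U) (B ─ N)
    condV V V⊆ = ℕ.+-cancelˡ-≤ ∣ U ∣ _ _ (ℕ.≤-trans
      (disjoint⇒∣p∣+∣q∣≤∣r∣ U V (U ∪ V) (p⊆p∪q V) (q⊆p∪q U V)
        (λ u∈U u∈V → proj₂ (x∈p─q⁻ A U (V⊆ u∈V)) u∈U))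
      (ℕ.≤-trans (cond (U ∪ V) (λ x∈ → [ U⊆A , p─q⊆p A U ∘ V⊆ ]′ (x∈p∪q⁻ U V x∈)))
      (ℕ.≤-trans (r⊆p∪q⇒∣r∣≤∣p∣+∣q∣ (neighbours B (U ∪ V)) N (neighbours (B ─ N) V)
          (λ w∈ → classify (sieve⁻ (Neighbour? B (U ∪ V)) w∈)))
        (ℕ.+-monoˡ-≤ _ N≤U))))
      where
      classify : ∀ {w} → Neighbour B (U ∪ V) w → w ∈ N ⊎ w ∈ neighbours (B ─ N) V
      classify {w} (w∈B , u , u∈UV , r) with w ∈? N | x∈p∪q⁻ U V u∈UV
      ... | yes w∈N | _        = inj₁ w∈N
      ... | no w∉N  | inj₁ u∈U = contradiction (sieve⁺ (Neighbour? B U) (w∈B , u , u∈U , r)) w∉N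
      ... | no w∉N  | inj₂ u∈V =
        inj₂ (sieve⁺ (Neighbour? (B ─ N) V) (x∈p∧x∉q⇒x∈p─q w∈B w∉N , u , u∈V , r))
  ... | no ¬tight with nonempty? (neighbours B ⁅ a ⁆)
  ...   | no empty = contradiction
            (ℕ.≤-trans (cond ⁅ a ⁆ (λ x∈ → subst (_∈ A) (sym (x∈⁅y⁆⇒x≡y a x∈)) a∈A))
              (subst (λ p → ∣ p ∣ ≤ 0) (sym (Empty-unique empty)) (ℕ.≤-reflexive (∣⊥∣≡0 n))))
            (subst (λ j → ¬ (j ≤ 0)) (sym (∣⁅x⁆∣≡1 a)) λ ())
  ...   | yes (b , b∈N) with sieve⁻ (Neighbour? B ⁅ a ⁆) b∈N
  ...     | b∈B , a′ , a′∈ , r = glue split disjoint ⊆B (p─q⊆p B ⁅ b ⁆) single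
              (hall k (A - a) (B - b) (ℕ.≤-pred (ℕ.<-≤-trans (x∈p⇒∣p-x∣<∣p∣ a∈A) A≤k)) condV)
    where
    ⊆B : ⁅ b ⁆ ⊆ B
    ⊆B x∈ = subst (_∈ B) (sym (x∈⁅y⁆⇒x≡y b x∈)) b∈B

    split : ∀ {u} → u ∈ A → u ∈ ⁅ a ⁆ ⊎ u ∈ A - a
    split {u} u∈A with u ≟ a
    ... | yes refl = inj₁ (x∈⁅x⁆ u)
    ... | no u≢a   = inj₂ (x∈p∧x≢y⇒x∈p-y u∈A u≢a)

    disjoint : ∀ {u} → u ∈ ⁅ b ⁆ → u ∉ B - b
    disjoint u∈ u∈′ = proj₂ (x∈p─q⁻ B ⁅ b ⁆ u∈′) u∈

    single : Matching ⁅ a ⁆ ⁅ b ⁆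
    single = record
      { mate = λ _ → b
      ; into = λ _ → x∈⁅x⁆ b
      ; related = λ u∈ → subst (λ u → R u b) (trans (x∈⁅y⁆⇒x≡y a a′∈) (sym (x∈⁅y⁆⇒x≡y a u∈))) r
      ; injective = λ u∈ v∈ _ → trans (x∈⁅y⁆⇒x≡y a u∈) (sym (x∈⁅y⁆⇒x≡y a v∈))
      }

    -- A nonempty `V` is smaller than `A` here and not tight, so it has more neighbours than
    -- elements; removing `b` costs at most one.
    condV : HallCondition (A - a) (B - b)
    condV V V⊆ with nonempty? V
    ... | no empty = subst (λ p → ∣ p ∣ ≤ ∣ neighbours (B - b) V ∣) (sym (Empty-unique empty))
                       (ℕ.≤-trans (ℕ.≤-reflexive (∣⊥∣≡0 n)) z≤n)
    ... | yes V≠∅ = ℕ.≤-pred (ℕ.≤-trans (ℕ.≰⇒> λ N≤V → ¬tight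
            (V , (λ x∈ → proj₁ (x∈p-y⁻ A a (V⊆ x∈))) , V≠∅
              , ℕ.≤-<-trans (p⊆q⇒∣p∣≤∣q∣ V⊆) (x∈p⇒∣p-x∣<∣p∣ a∈A) , N≤V))
          (ℕ.≤-trans (∣p∣≤1+∣p-x∣ (neighbours B V) b) (s≤s (p⊆q⇒∣p∣≤∣q∣ λ w∈ →
            case x∈p-y⁻ (neighbours B V) b w∈ of λ (w∈N , w≢b) →
            case sieve⁻ (Neighbour? B V) w∈N of λ (w∈B , u , u∈V , ruw) →
              sieve⁺ (Neighbour? (B - b) V) (x∈p∧x≢y⇒x∈p-y w∈B w≢b , u , u∈V , ruw)))))

  matchingOrViolator : ∀ A B →
    Matching A B ⊎ (∃[ U ] (U ⊆ A × ∣ neighbours B U ∣ < ∣ U ∣))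
  matchingOrViolator A B with anySubset? (λ U → (U ⊆? A) ×-dec (∣ neighbours B U ∣ ℕ.<? ∣ U ∣))
  ... | yes violator = inj₂ violator
  ... | no ¬violator = inj₁ (hall ∣ A ∣ A B ℕ.≤-refl λ U U⊆A → ℕ.≮⇒≥ λ N<U → ¬violator (U , U⊆A , N<U))

-- Menger's theorem, for connected sets in place of paths

Walk : ∀ {m} → Rel (Fin m) 0ℓ → Pred (Fin m) 0ℓ → Rel (Fin m) 0ℓ
Walk _~_ P = Star λ e f → P e × P f × e ~ f

module _ {m} {_~_ : Rel (Fin m) 0ℓ} where

  walk-mono : ∀ {P Q : Pred (Fin m) 0ℓ} → (∀ {e} → P e → Q e) → ∀ {e f} → Walk _~_ P e f → Walk _~_ Q e f
  walk-mono P⊆Q = gmap id λ (p , q , e~f) → P⊆Q p , P⊆Q q , e~f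

  walk-reverse : Symmetric _~_ → ∀ {P e f} → Walk _~_ P e f → Walk _~_ P f e
  walk-reverse ~-sym ε                     = ε
  walk-reverse ~-sym ((p , q , e~g) ◅ w) = walk-reverse ~-sym w ◅◅ (q , p , ~-sym e~g) ◅ ε

-- Reflexivity allows a matching to fix the elements that lie on no path; for a Hall violator `U` it
-- puts the part of `U` outside `X` among the neighbours of `U`.
module Menger {m} {_~_ : Rel (Fin m) 0ℓ} (~-refl : ∀ {e} → e ~ e) (_~?_ : Decidable _~_) where

  record Linkage (E X Y : Subset m) : Set₁ where
    field
      Path      : Rel (Fin m) 0ℓ
      Path?     : Decidable Path
      start     : ∀ {x} → x ∈ X → Path x x
      within    : ∀ {x e} → x ∈ X → Path x e → e ∈ E
      disjoint  : ∀ {x x′ e} → x ∈ X → x′ ∈ X → Path x e → Path x′ e → x ≡ x′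
      connected : ∀ {x e} → x ∈ X → Path x e → Walk _~_ (Path x) x e
      end       : ∀ {x} → x ∈ X → ∃[ y ] (y ∈ Y × Path x y)

  -- U is a union of components of E ∖ S that avoids Y.
  record Separation (E X Y : Subset m) : Set where
    field
      U S   : Subset m
      U⊆E   : U ⊆ E
      S⊆E   : S ⊆ E
      start : ∀ {x} → x ∈ X → x ∈ U ⊎ x ∈ S
      step  : ∀ {u f} → u ∈ U → f ∈ E → u ~ f → f ∈ U ⊎ f ∈ S
      U#S   : ∀ {e} → e ∈ U → e ∉ S
      U#Y   : ∀ {e} → e ∈ U → e ∉ Y
      small : ∣ S ∣ < ∣ X ∣

  module _ {E X Y : Subset m} (X⊆E : X ⊆ E) where
    open Hall _~?_

    -- An injection E ∖ Y → E ∖ X that moves each edge to itself or to a neighbour gives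
    -- a linkage: follow it from X; the orbit leaves X for good, so it can only stop in Y.
    module _ (M : Matching (E ─ Y) (E ─ X)) where
      open Matching M

      orbit : ℕ → Fin m → List (Fin m)
      orbit zero    e = e ∷ []
      orbit (suc k) e with e ∈? Y
      ... | yes _ = e ∷ []
      ... | no _  = e ∷ orbit k (mate e)

      data Reach (x : Fin m) : Fin m → Set where
        stay : Reach x x
        move : ∀ {e} → Reach x e → e ∈ E ─ Y → Reach x (mate e)

      Reach-inside : ∀ {x e} → x ∈ X → Reach x e → e ∈ E
      Reach-inside x∈X stay       = X⊆E x∈X
      Reach-inside x∈X (move r u) = p─q⊆p E X (into u)

      mate∉X : ∀ {e} → e ∈ E ─ Y → mate e ∉ X
      mate∉X = proj₂ ∘ x∈p─q⁻ E X ∘ into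

      -- Both orbits can be traced back in step, as `mate` is injective, and neither start can be
      -- passed, as mates avoid `X`. The equation is a separate argument because `mate e` and
      -- `mate e′` do not unify.
      Reach-deterministic : ∀ {x x′ e e′} → x ∈ X → x′ ∈ X → e ≡ e′ → Reach x e → Reach x′ e′ → x ≡ x′
      Reach-deterministic x∈ x′∈ eq stay stay = eq
      Reach-deterministic x∈ x′∈ eq stay (move r u) = contradiction (subst (_∈ X) eq x∈) (mate∉X u)
      Reach-deterministic x∈ x′∈ eq (move r u) stay = contradiction (subst (_∈ X) (sym eq) x′∈) (mate∉X u)
      Reach-deterministic x∈ x′∈ eq (move r u) (move r′ u′) =
        Reach-deterministic x∈ x′∈ (injective u u′ eq) r r′

      orbit-sound : ∀ k {x e f} → x ∈ X → Reach x e → f List.∈ orbit k e → Reach x f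
      orbit-sound zero x∈X r (here refl) = r
      orbit-sound (suc k) {e = e} x∈X r f∈ with e ∈? Y | f∈
      ... | yes _  | here refl = r
      ... | no _   | here refl = r
      ... | no e∉Y | there f∈′ =
        orbit-sound k x∈X (move r (x∈p∧x∉q⇒x∈p─q (Reach-inside x∈X r) e∉Y)) f∈′

      orbit-start : ∀ k e → e List.∈ orbit k e
      orbit-start zero e = here refl
      orbit-start (suc k) e with e ∈? Y
      ... | yes _ = here refl
      ... | no _  = here refl

      orbit-walk : ∀ k {e f} → e ∈ E → f List.∈ orbit k e → Walk _~_ (List._∈ orbit k e) e f
      orbit-walk zero e∈E (here refl) = ε
      orbit-walk (suc k) {e} e∈E f∈ with e ∈? Y | f∈
      ... | yes _  | here refl = ε
      ... | no _   | here refl = ε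
      ... | no e∉Y | there f∈′ =
        (here refl , there (orbit-start k (mate e)) , related e∈)
        ◅ walk-mono there (orbit-walk k (p─q⊆p E X (into e∈)) f∈′)
        where
        e∈ : e ∈ E ─ Y
        e∈ = x∈p∧x∉q⇒x∈p─q e∈E e∉Y

      iterate : ℕ → Fin m → Fin m
      iterate zero    e = e
      iterate (suc i) e = mate (iterate i e)

      iterate-∈ : ∀ {x} → x ∈ X → ∀ i → (∀ j → j < i → iterate j x ∉ Y) → iterate i x ∈ E
      iterate-∈ x∈X zero    _   = X⊆E x∈X
      iterate-∈ x∈X (suc i) ∉Y = p─q⊆p E X (into (x∈p∧x∉q⇒x∈p─q
        (iterate-∈ x∈X i λ j j<i → ∉Y j (ℕ.m≤n⇒m≤1+n j<i)) (∉Y i ℕ.≤-refl)))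

      iterate-mate : ∀ i e → iterate i (mate e) ≡ iterate (suc i) e
      iterate-mate zero    e = refl
      iterate-mate (suc i) e = cong mate (iterate-mate i e)

      iterate-∈-orbit : ∀ k {e} → (∀ {f} → f List.∈ orbit k e → f ∉ Y) → ∀ i → i ≤ k → iterate i e List.∈ orbit k e
      iterate-∈-orbit k {e} _ zero _ = orbit-start k e
      iterate-∈-orbit (suc k) {e} ∉Y (suc i) (s≤s i≤k) with e ∈? Y
      ... | yes e∈Y = contradiction e∈Y (∉Y (here refl))
      ... | no _    = there (subst (List._∈ orbit k (mate e)) (iterate-mate i e)
                        (iterate-∈-orbit k (λ f∈ → ∉Y (there f∈)) i i≤k))

      -- Injectivity of `mate` shifts a coincidence back until one side is `x` itself; that is in
      -- `X`, where no mate lies.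
      iterates-distinct : ∀ {x} → x ∈ X → ∀ i j → i < j →
        (∀ l → l < j → iterate l x ∉ Y) → iterate i x ≢ iterate j x
      iterates-distinct x∈X zero (suc j) _ ∉Y eq =
        mate∉X (x∈p∧x∉q⇒x∈p─q (iterate-∈ x∈X j λ l l<j → ∉Y l (ℕ.m≤n⇒m≤1+n l<j)) (∉Y j ℕ.≤-refl))
          (subst (_∈ X) eq x∈X)
      iterates-distinct {x} x∈X (suc i) (suc j) (s≤s i<j) ∉Y eq =
        iterates-distinct x∈X i j i<j ∉Y′ (injective (∈dom i (ℕ.<⇒≤ i<j)) (∈dom j ℕ.≤-refl) eq)
        where
        ∉Y′ : ∀ l → l < j → iterate l x ∉ Y
        ∉Y′ l l<j = ∉Y l (ℕ.m≤n⇒m≤1+n l<j)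

        ∈dom : ∀ l → l ≤ j → iterate l x ∈ E ─ Y
        ∈dom l l≤j = x∈p∧x∉q⇒x∈p─q (iterate-∈ x∈X l λ k k<l → ∉Y′ k (ℕ.<-≤-trans k<l l≤j)) (∉Y l (s≤s l≤j))

      -- Otherwise the first `m + 1` iterates would avoid `Y` and hence be distinct elements of
      -- `Fin m`. So fuel `m` is enough.
      orbit-ends : ∀ {x} → x ∈ X → ∃[ y ] (y ∈ Y × y List.∈ orbit m x)
      orbit-ends {x} x∈X with Any.any? (_∈? Y) (orbit m x)
      ... | yes hit = case List.find hit of λ (y , y∈ , y∈Y) → y , y∈Y , y∈
      ... | no ¬hit with pigeonhole (ℕ.n<1+n m) (λ i → iterate (toℕ i) x)
      ...   | i , j , i<j , eq = contradiction eq (iterates-distinct x∈X (toℕ i) (toℕ j) i<j λ l l<j l∈Y →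
                ¬hit (List.lose (iterate-∈-orbit m ∉Y l (ℕ.≤-pred (ℕ.≤-trans l<j (ℕ.≤-trans (toℕ≤n j) ℕ.≤-refl)))) l∈Y))
        where
        ∉Y : ∀ {f} → f List.∈ orbit m x → f ∉ Y
        ∉Y f∈ f∈Y = ¬hit (List.lose f∈ f∈Y)

      linkage : Linkage E X Y
      linkage = record
        { Path      = λ x e → e List.∈ orbit m x
        ; Path?     = λ x e → Any.any? (e ≟_) (orbit m x)
        ; start     = λ _ → orbit-start m _
        ; within    = λ x∈X e∈ → Reach-inside x∈X (orbit-sound m x∈X stay e∈)
        ; disjoint  = λ x∈X x′∈X e∈ e∈′ → Reach-deterministic x∈X x′∈X refl
                        (orbit-sound m x∈X stay e∈) (orbit-sound m x′∈X stay e∈′)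
        ; connected = λ x∈X → orbit-walk m (X⊆E x∈X)
        ; end       = orbit-ends
        }

    -- The violator itself is the side cut off, and its border together with the rest of `X` is `S`.
    -- As `S ∪ U` is covered by `X` and the neighbours of `U` outside `X`, `∣ S ∣ + ∣ U ∣` is less
    -- than `∣ X ∣ + ∣ U ∣`.
    separation : ∀ U → U ⊆ E ─ Y → ∣ neighbours (E ─ X) U ∣ < ∣ U ∣ → Separation E X Y
    separation U U⊆ N<U = record
      { U = U
      ; S = S
      ; U⊆E = p─q⊆p E Y ∘ U⊆
      ; S⊆E = proj₁ ∘ sieve⁻ Border?
      ; start = λ x∈X → classify (X⊆E x∈X) (inj₁ x∈X)
      ; step = λ u∈U f∈E u~f → classify f∈E (inj₂ (_ , u∈U , u~f))
      ; U#S = U#S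
      ; U#Y = proj₂ ∘ x∈p─q⁻ E Y ∘ U⊆
      ; small = ℕ.+-cancelʳ-< ∣ U ∣ _ _ (ℕ.≤-<-trans
          (disjoint⇒∣p∣+∣q∣≤∣r∣ S U (S ∪ U) (p⊆p∪q U) (q⊆p∪q S U) (flip U#S))
          (ℕ.≤-<-trans (r⊆p∪q⇒∣r∣≤∣p∣+∣q∣ (S ∪ U) X (neighbours (E ─ X) U) (cover ∘ x∈p∪q⁻ S U))
            (ℕ.+-monoʳ-< ∣ X ∣ N<U)))
      }
      where
      Border : Pred (Fin m) 0ℓ
      Border s = s ∈ E × s ∉ U × (s ∈ X ⊎ ∃[ u ] (u ∈ U × u ~ s))

      Border? : Decidable₁ Border
      Border? s = (s ∈? E) ×-dec ¬? (s ∈? U) ×-dec ((s ∈? X) ⊎-dec any? λ u → (u ∈? U) ×-dec (u ~? s))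

      S : Subset m
      S = sieve Border?

      U#S : ∀ {e} → e ∈ U → e ∉ S
      U#S e∈U e∈S = proj₁ (proj₂ (sieve⁻ Border? e∈S)) e∈U

      classify : ∀ {f} → f ∈ E → f ∈ X ⊎ (∃[ u ] (u ∈ U × u ~ f)) → f ∈ U ⊎ f ∈ S
      classify {f} f∈E h with f ∈? U
      ... | yes f∈U = inj₁ f∈U
      ... | no f∉U  = inj₂ (sieve⁺ Border? (f∈E , f∉U , h))

      reached : ∀ {f} → f ∈ E → ∃[ u ] (u ∈ U × u ~ f) → f ∈ X ⊎ f ∈ neighbours (E ─ X) U
      reached {f} f∈E h with f ∈? X
      ... | yes f∈X = inj₁ f∈X
      ... | no f∉X  = inj₂ (sieve⁺ (Neighbour? (E ─ X) U) (x∈p∧x∉q⇒x∈p─q f∈E f∉X , h))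

      cover : ∀ {f} → f ∈ S ⊎ f ∈ U → f ∈ X ⊎ f ∈ neighbours (E ─ X) U
      cover (inj₂ f∈U) = reached (p─q⊆p E Y (U⊆ f∈U)) (_ , f∈U , ~-refl)
      cover (inj₁ f∈S) with sieve⁻ Border? f∈S
      ... | _   , _ , inj₁ f∈X = inj₁ f∈X
      ... | f∈E , _ , inj₂ h   = reached f∈E h

    menger : Linkage E X Y ⊎ Separation E X Y
    menger with matchingOrViolator (E ─ Y) (E ─ X)
    ... | inj₁ M                = inj₁ (linkage M)
    ... | inj₂ (U , U⊆ , N<U) = inj₂ (separation U U⊆ N<U)

-- Kempe colourings and rooted minors

-- Loops are allowed, unlike in `Graph`: contraction turns the edges that it drops into loops, so
-- `Kempe` forbids them only inside `E`.
Ends : ℕ → ℕ → Set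
Ends n m = Fin m → Fin n × Fin n

module _ {n m} (h : Ends n m) where

  Inc : Fin n → Fin m → Set
  Inc v e = v ≡ proj₁ (h e) ⊎ v ≡ proj₂ (h e)

  Inc? : Decidable Inc
  Inc? v e = (v ≟ proj₁ (h e)) ⊎-dec (v ≟ proj₂ (h e))

  Touch : Rel (Fin m) 0ℓ
  Touch e f = ∃[ v ] (Inc v e × Inc v f)

  touch-refl : ∀ {e} → Touch e e
  touch-refl = _ , inj₁ refl , inj₁ refl

  touch-sym : Symmetric Touch
  touch-sym (v , p , q) = v , q , p

  touch? : Decidable Touch
  touch? e f = any? λ v → Inc? v e ×-dec Inc? v f

  -- The branching sets are indexed by their roots. The reflexive `Touch` can replace adjacency
  -- because distinct branches share no edge.
  record RootedMinor (E T : Subset m) : Set₁ where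
    field
      Branch    : Rel (Fin m) 0ℓ
      Branch?   : Decidable Branch
      root      : ∀ {t} → t ∈ T → Branch t t
      within    : ∀ {t e} → t ∈ T → Branch t e → e ∈ E
      disjoint  : ∀ {t t′ e} → t ∈ T → t′ ∈ T → Branch t e → Branch t′ e → t ≡ t′
      connected : ∀ {t e} → t ∈ T → Branch t e → Walk Touch (Branch t) t e
      adjacent  : ∀ {t t′} → t ∈ T → t′ ∈ T → t ≢ t′ →
                  ∃[ e ] ∃[ e′ ] (Branch t e × Branch t′ e′ × Touch e e′)

  -- E is the set of edges in use; the colour of an edge is the element of T in its class.
  record Kempe (E T : Subset m) (col : Fin m → Fin m) : Set where
    Bicoloured : Fin m → Fin m → Pred (Fin m) 0ℓ
    Bicoloured s t e = e ∈ E × (col e ≡ s ⊎ col e ≡ t)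

    field
      T⊆E      : T ⊆ E
      col-∈    : ∀ {e} → e ∈ E → col e ∈ T
      col-fix  : ∀ {t} → t ∈ T → col t ≡ t
      loopless : ∀ {e} → e ∈ E → proj₁ (h e) ≢ proj₂ (h e)
      proper   : ∀ {e f v} → e ∈ E → f ∈ E → Inc v e → Inc v f → col e ≡ col f → e ≡ f
      kempe    : ∀ {s t} → s ∈ T → t ∈ T → s ≢ t → ∀ {e f} → Bicoloured s t e → Bicoloured s t f →
                 Walk Touch (Bicoloured s t) e f

-- A vertex incident with all colours

module FullVertex {n m} {h : Ends n m} {E T : Subset m} {col : Fin m → Fin m} (K : Kempe h E T col)
  {v : Fin n} (full : ∀ {t} → t ∈ T → ∃[ f ] (f ∈ E × col f ≡ t × Inc h v f)) where

  open Kempe K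
  open Menger {_~_ = Touch h} (touch-refl h) (touch? h)

  AtV? : Decidable₁ (λ f → f ∈ E × Inc h v f)
  AtV? f = (f ∈? E) ×-dec Inc? h v f

  Y : Subset m
  Y = sieve AtV?

  linked : Linkage E T Y → RootedMinor h E T
  linked P = record
    { Branch = Path
    ; Branch? = Path?
    ; root = start
    ; within = within
    ; disjoint = disjoint
    ; connected = connected
    ; adjacent = λ t∈T t′∈T _ → case end t∈T , end t′∈T of λ ((y , y∈ , p) , (y′ , y′∈ , p′)) →
        y , y′ , p , p′ , v , proj₂ (sieve⁻ AtV? y∈) , proj₂ (sieve⁻ AtV? y′∈)
    }
    where open Linkage P

  module Separated (Sep : Separation E T Y) where
    open Separation Sep

    exit : ∀ {s t e f} → Walk (Touch h) (Bicoloured s t) e f → e ∈ U → f ∉ U →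
      ∃[ g ] (g ∈ S × Bicoloured s t g × ∃[ u ] (u ∈ U × Touch h u g))
    exit ε e∈U f∉U = contradiction e∈U f∉U
    exit ((_ , bg , e~g) ◅ w) e∈U f∉U with step e∈U (proj₁ bg) e~g
    ... | inj₁ g∈U = exit w g∈U f∉U
    ... | inj₂ g∈S = _ , g∈S , bg , _ , e∈U , e~g

    -- Colours `s` and `t` contain a walk from `s` to the edge of colour `s` at `v`. It starts in
    -- `U` and ends outside, so it leaves `U` through `S`.
    cut : ∀ {s t} → s ∈ T → t ∈ T → s ≢ t → s ∉ S →
      ∃[ g ] (g ∈ S × Bicoloured s t g × ∃[ u ] (u ∈ U × Touch h u g))
    cut s∈T t∈T s≢t s∉S with start s∈T | full s∈T
    ... | inj₂ s∈S | _ = contradiction s∈S s∉S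
    ... | inj₁ s∈U | f , f∈E , cf , inc =
      exit (kempe s∈T t∈T s≢t (T⊆E s∈T , inj₁ (col-fix s∈T)) (f∈E , inj₁ cf)) s∈U
        (λ f∈U → U#Y f∈U (sieve⁺ AtV? (f∈E , inc)))

    Misses : Fin m → Set
    Misses t = ∀ {e} → e ∈ S → col e ≢ t

    misses⇒∉ : ∀ {t} → t ∈ T → Misses t → t ∉ S
    misses⇒∉ t∈T miss t∈S = miss t∈S (col-fix t∈T)

    misses-unique : ∀ {s t} → s ∈ T → t ∈ T → s ≢ t → Misses s → ¬ Misses t
    misses-unique s∈T t∈T s≢t ms mt with cut s∈T t∈T s≢t (misses⇒∉ s∈T ms)
    ... | g , g∈S , (_ , inj₁ cg) , _ = ms g∈S cg
    ... | g , g∈S , (_ , inj₂ cg) , _ = mt g∈S cg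

    -- Otherwise `S` would miss two colours. This holds for every separation; `outer-linkage`
    -- applies it to a second one.
    ∣T∣≤1+∣S∣ : ∣ T ∣ ≤ suc ∣ S ∣
    ∣T∣≤1+∣S∣ = ℕ.≮⇒≥ λ S+1<T → case missed S T col small of λ (t , t∈T , mt) →
      case missed S (T - t) col (ℕ.≤-pred (ℕ.≤-trans S+1<T (∣p∣≤1+∣p-x∣ T t))) of λ (s , s∈ , ms) →
      case x∈p-y⁻ T t s∈ of λ (s∈T , s≢t) → misses-unique s∈T t∈T s≢t ms mt

  module Contract (Sep : Separation E T Y) where
    open Separation Sep
    open Separated Sep

    t₀ : Fin m
    t₀ = proj₁ (missed S T col small)

    t₀∈T : t₀ ∈ T
    t₀∈T = proj₁ (proj₂ (missed S T col small))

    t₀-missed : Misses t₀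
    t₀-missed = proj₂ (proj₂ (missed S T col small))

    -- If `f` repeats a colour of `S`, then `S - f` shows the same colours as `S` but is too small
    -- to show all colours except `t₀`; so `S` would miss a second one.
    S-rainbow : ∀ {e f} → e ∈ S → f ∈ S → col e ≡ col f → e ≡ f
    S-rainbow {e} {f} e∈S f∈S ce≡cf with e ≟ f
    ... | yes e≡f = e≡f
    ... | no e≢f with missed (S - f) (T - t₀) col (ℕ.<-≤-trans (x∈p⇒∣p-x∣<∣p∣ f∈S)
                    (ℕ.≤-pred (ℕ.≤-trans small (∣p∣≤1+∣p-x∣ T t₀))))
    ...   | t , t∈ , mt = ⊥-elim (misses-unique t₀∈T (proj₁ (x∈p-y⁻ T t₀ t∈))
              (λ eq → proj₂ (x∈p-y⁻ T t₀ t∈) (sym eq)) t₀-missed t-missed)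
      where
      t-missed : Misses t
      t-missed {g} g∈S cg with g ≟ f
      ... | yes refl = mt (x∈p∧x≢y⇒x∈p-y e∈S e≢f) (trans ce≡cf cg)
      ... | no g≢f   = mt (x∈p∧x≢y⇒x∈p-y g∈S g≢f) cg

    -- These are the edges of `E` with an end covered by `U`; all others become loops at `v`.
    Live : Pred (Fin m) 0ℓ
    Live e = e ∈ E × ∃[ u ] (u ∈ U × Touch h u e)

    Live? : Decidable₁ Live
    Live? e = (e ∈? E) ×-dec any? λ u → (u ∈? U) ×-dec touch? h u e

    E′ : Subset m
    E′ = sieve Live?

    E′⊆E : E′ ⊆ E
    E′⊆E = proj₁ ∘ sieve⁻ Live?

    U⊆E′ : U ⊆ E′
    U⊆E′ u∈U = sieve⁺ Live? (U⊆E u∈U , _ , u∈U , touch-refl h)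

    Covered : Pred (Fin n) 0ℓ
    Covered x = ∃[ u ] (u ∈ U × Inc h x u)

    Covered? : Decidable₁ Covered
    Covered? x = any? λ u → (u ∈? U) ×-dec Inc? h x u

    r : Fin n → Fin n
    r x with Covered? x
    ... | yes _ = x
    ... | no _  = v

    v-uncovered : ¬ Covered v
    v-uncovered (u , u∈U , inc) = U#Y u∈U (sieve⁺ AtV? (U⊆E u∈U , inc))

    r-uncovered : ∀ {x} → ¬ Covered x → r x ≡ v
    r-uncovered {x} ¬c with Covered? x
    ... | yes c = contradiction c ¬c
    ... | no _  = refl

    r-≡ : ∀ {x y} → r x ≡ r y → x ≡ y ⊎ (¬ Covered x × ¬ Covered y)
    r-≡ {x} {y} eq with Covered? x | Covered? y
    ... | yes _  | yes _  = inj₁ eq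
    ... | yes cx | no _   = contradiction (subst Covered eq cx) v-uncovered
    ... | no _   | yes cy = contradiction (subst Covered (sym eq) cy) v-uncovered
    ... | no ¬cx | no ¬cy = inj₂ (¬cx , ¬cy)

    h′ : Ends n m
    h′ e = r (proj₁ (h e)) , r (proj₂ (h e))

    inc⇒inc′ : ∀ {x e} → Inc h x e → Inc h′ (r x) e
    inc⇒inc′ (inj₁ refl) = inj₁ refl
    inc⇒inc′ (inj₂ refl) = inj₂ refl

    inc′⇒inc : ∀ {x e} → Inc h′ x e → ∃[ y ] (Inc h y e × r y ≡ x)
    inc′⇒inc (inj₁ refl) = _ , inj₁ refl , refl
    inc′⇒inc (inj₂ refl) = _ , inj₂ refl , refl

    touch⇒touch′ : ∀ {e f} → Touch h e f → Touch h′ e f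
    touch⇒touch′ (x , p , q) = r x , inc⇒inc′ p , inc⇒inc′ q

    covered-end : ∀ {e} → e ∈ E′ → ∃[ x ] (Inc h x e × Covered x)
    covered-end e∈E′ with sieve⁻ Live? e∈E′
    ... | _ , u , u∈U , x , xu , xe = x , xe , u , u∈U , xu

    ∉U⇒∈S : ∀ {e} → e ∈ E′ → e ∉ U → e ∈ S
    ∉U⇒∈S e∈E′ e∉U with sieve⁻ Live? e∈E′
    ... | e∈E , u , u∈U , u~e with step u∈U e∈E u~e
    ...   | inj₁ e∈U = contradiction e∈U e∉U
    ...   | inj₂ e∈S = e∈S

    uncovered-end⇒∈S : ∀ {e x} → e ∈ E′ → Inc h x e → ¬ Covered x → e ∈ S
    uncovered-end⇒∈S e∈E′ xe ¬c = ∉U⇒∈S e∈E′ λ e∈U → ¬c (_ , e∈U , xe)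

    covered-end⇒∈E′ : ∀ {e x} → e ∈ E → Inc h x e → Covered x → e ∈ E′
    covered-end⇒∈E′ e∈E xe (u , u∈U , xu) = sieve⁺ Live? (e∈E , u , u∈U , _ , xu , xe)

    -- A contact created by the contraction is at `v`, between uncovered ends, and an edge of `E′`
    -- with an uncovered end is in `S`.
    touch′⇒touch : ∀ {e f} → e ∈ E′ → f ∈ E′ → Touch h′ e f → Touch h e f ⊎ (e ∈ S × f ∈ S)
    touch′⇒touch e∈ f∈ (x , p , q) with inc′⇒inc p | inc′⇒inc q
    ... | y , ye , ry | z , zf , rz with r-≡ (trans ry (sym rz))
    ...   | inj₁ refl          = inj₁ (y , ye , zf)
    ...   | inj₂ (¬cy , ¬cz) = inj₂ (uncovered-end⇒∈S e∈ ye ¬cy , uncovered-end⇒∈S f∈ zf ¬cz)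

    -- If `t` is in `S`, `cut` for `t₀` and `t` yields an edge of `S` of colour `t` that touches
    -- `U`. It is `t`, since no colour repeats in `S`.
    T⊆E′ : T ⊆ E′
    T⊆E′ {t} t∈T with start t∈T
    ... | inj₁ t∈U = U⊆E′ t∈U
    ... | inj₂ t∈S with t₀ ≟ t
    ...   | yes refl = contradiction t∈S (misses⇒∉ t₀∈T t₀-missed)
    ...   | no t₀≢t with cut t₀∈T t∈T t₀≢t (misses⇒∉ t₀∈T t₀-missed)
    ...     | g , g∈S , (_ , inj₁ cg) , _ = contradiction cg (t₀-missed g∈S)
    ...     | g , g∈S , (g∈E , inj₂ cg) , touched =
                subst (_∈ E′) (S-rainbow g∈S t∈S (trans cg (sym (col-fix t∈T)))) (sieve⁺ Live? (g∈E , touched))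

    -- The edge of colour `t₀` at `v` is dropped: it is not in `U`, which avoids `Y`, nor in `S`,
    -- which misses `t₀`.
    E′<E : ∣ E′ ∣ < ∣ E ∣
    E′<E with full t₀∈T
    ... | f , f∈E , cf , inc = p⊂q⇒∣p∣<∣q∣ (E′⊆E , f , f∈E , λ f∈E′ →
      t₀-missed (∉U⇒∈S f∈E′ (λ f∈U → U#Y f∈U (sieve⁺ AtV? (f∈E , inc)))) cf)

    Bicoloured′ : Fin m → Fin m → Pred (Fin m) 0ℓ
    Bicoloured′ s t e = e ∈ E′ × (col e ≡ s ⊎ col e ≡ t)

    -- Segments of a walk outside E′ lie among the identified vertices and are skipped;
    -- e is the last edge in E′ met so far.
    contract-walk : ∀ {s t f} → f ∈ E′ → ∀ {g} → Walk (Touch h) (Bicoloured s t) g f →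
      (g ∈ E′ → Walk (Touch h′) (Bicoloured′ s t) g f) ×
      (g ∉ E′ → ∀ {e} → Bicoloured′ s t e → Inc h′ v e → Walk (Touch h′) (Bicoloured′ s t) e f)
    contract-walk f∈E′ ε = (λ _ → ε) , λ g∉E′ → contradiction f∈E′ g∉E′
    contract-walk {s} {t} {f} f∈E′ {g} (_◅_ {j = k} (bg , bk , g~k@(x , xg , xk)) w)
      with contract-walk f∈E′ w
    ... | live , dead = from-live , from-dead
      where
      from-live : g ∈ E′ → Walk (Touch h′) (Bicoloured′ s t) g f
      from-live g∈E′ with k ∈? E′
      ... | yes k∈E′ = ((g∈E′ , proj₂ bg) , (k∈E′ , proj₂ bk) , touch⇒touch′ g~k) ◅ live k∈E′
      ... | no k∉E′  = dead k∉E′ (g∈E′ , proj₂ bg)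
        (subst (λ y → Inc h′ y g) (r-uncovered λ c → k∉E′ (covered-end⇒∈E′ (proj₁ bk) xk c)) (inc⇒inc′ xg))

      from-dead : g ∉ E′ → ∀ {e} → Bicoloured′ s t e → Inc h′ v e → Walk (Touch h′) (Bicoloured′ s t) e f
      from-dead g∉E′ be ve with k ∈? E′
      ... | yes k∈E′ = (be , (k∈E′ , proj₂ bk) , v , ve ,
        subst (λ y → Inc h′ y k) (r-uncovered λ c → g∉E′ (covered-end⇒∈E′ (proj₁ bg) xg c)) (inc⇒inc′ xk)) ◅ live k∈E′
      ... | no k∉E′  = dead k∉E′ be ve

    contracted : Kempe h′ E′ T col
    contracted = record
      { T⊆E = T⊆E′
      ; col-∈ = col-∈ ∘ E′⊆E
      ; col-fix = col-fix
      ; loopless = loopless′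
      ; proper = λ e∈ f∈ xe xf ce≡cf → case inc′⇒inc xe , inc′⇒inc xf of λ ((y , ye , ry) , (z , zf , rz)) →
          case r-≡ (trans ry (sym rz)) of λ
            { (inj₁ refl) → proper (E′⊆E e∈) (E′⊆E f∈) ye zf ce≡cf
            ; (inj₂ (¬cy , ¬cz)) → S-rainbow (uncovered-end⇒∈S e∈ ye ¬cy) (uncovered-end⇒∈S f∈ zf ¬cz) ce≡cf }
      ; kempe = λ s∈T t∈T s≢t (e∈ , ce) (f∈ , cf) →
          proj₁ (contract-walk f∈ (kempe s∈T t∈T s≢t (E′⊆E e∈ , ce) (E′⊆E f∈ , cf))) e∈
      }
      where
      loopless′ : ∀ {e} → e ∈ E′ → r (proj₁ (h e)) ≢ r (proj₂ (h e))
      loopless′ e∈ eq with r-≡ eq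
      ... | inj₁ eq′ = loopless (E′⊆E e∈) eq′
      ... | inj₂ (¬c₁ , ¬c₂) with covered-end e∈
      ...   | _ , inj₁ refl , c = ¬c₁ c
      ...   | _ , inj₂ refl , c = ¬c₂ c

    -- A separation of `S` from `Y` outside `U`, enlarged by `U`, would separate `T` from `Y` by at
    -- least two edges fewer than `∣ T ∣`, which `∣T∣≤1+∣S∣` excludes.
    outer-linkage : Linkage (E ─ U) S Y
    outer-linkage with menger {E ─ U} {S} {Y} (λ s∈S → x∈p∧x∉q⇒x∈p─q (S⊆E s∈S) (λ s∈U → U#S s∈U s∈S))
    ... | inj₁ P    = P
    ... | inj₂ Sep′ = contradiction (ℕ.≤-trans (Separated.∣T∣≤1+∣S∣ combined) (s≤s ℕ.≤-refl))
                        (ℕ.<⇒≱ (ℕ.≤-<-trans S′.small small))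
      where
      module S′ = Separation Sep′

      combined : Separation E T Y
      combined = record
        { U = U ∪ S′.U
        ; S = S′.S
        ; U⊆E = λ x∈ → [ U⊆E , p─q⊆p E U ∘ S′.U⊆E ]′ (x∈p∪q⁻ U S′.U x∈)
        ; S⊆E = p─q⊆p E U ∘ S′.S⊆E
        ; start = λ x∈T → [ inj₁ ∘ p⊆p∪q S′.U , [ inj₁ ∘ q⊆p∪q U S′.U , inj₂ ]′ ∘ S′.start ]′ (start x∈T)
        ; step = λ u∈ f∈E u~f → [ (λ u∈U → [ inj₁ ∘ p⊆p∪q S′.U , [ inj₁ ∘ q⊆p∪q U S′.U , inj₂ ]′ ∘ S′.start ]′ (step u∈U f∈E u~f))
                                , (λ u∈U′ → step′ u∈U′ f∈E u~f) ]′ (x∈p∪q⁻ U S′.U u∈)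
        ; U#S = λ e∈ e∈S′ → [ proj₂ (x∈p─q⁻ E U (S′.S⊆E e∈S′)) , (λ e∈U′ → S′.U#S e∈U′ e∈S′) ]′ (x∈p∪q⁻ U S′.U e∈)
        ; U#Y = λ e∈ → [ U#Y , S′.U#Y ]′ (x∈p∪q⁻ U S′.U e∈)
        ; small = ℕ.<-trans S′.small small
        }
        where
        step′ : ∀ {u f} → u ∈ S′.U → f ∈ E → Touch h u f → f ∈ U ∪ S′.U ⊎ f ∈ S′.S
        step′ {f = f} u∈U′ f∈E u~f with f ∈? U
        ... | yes f∈U = inj₁ (p⊆p∪q S′.U f∈U)
        ... | no f∉U  = [ inj₁ ∘ q⊆p∪q U S′.U , inj₂ ]′ (S′.step u∈U′ (x∈p∧x∉q⇒x∈p─q f∈E f∉U) u~f)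

    -- Each branch is extended by the outer paths that start in it. A contact lost in undoing the
    -- contraction was between two edges of `S`; their paths lead to edges at `v`, which touch.
    lift : RootedMinor h′ E′ T → RootedMinor h E T
    lift M = record
      { Branch = Branch
      ; Branch? = λ t e → M.Branch? t e ⊎-dec any? λ s → (s ∈? S) ×-dec M.Branch? t s ×-dec P.Path? s e
      ; root = inj₁ ∘ M.root
      ; within = λ { t∈T (inj₁ b) → E′⊆E (M.within t∈T b)
                   ; t∈T (inj₂ (s , s∈S , _ , p)) → p─q⊆p E U (P.within s∈S p) }
      ; disjoint = disjoint
      ; connected = connected
      ; adjacent = adjacent
      }
      where
      module M = RootedMinor M
      module P = Linkage outer-linkage

      Branch : Rel (Fin m) 0ℓ
      Branch t e = M.Branch t e ⊎ ∃[ s ] (s ∈ S × M.Branch t s × P.Path s e)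

      -- Outer paths avoid `U`, and `E′` outside `U` is in `S`, each element of which starts its own
      -- path.
      Path∩E′ : ∀ {s e} → s ∈ S → P.Path s e → e ∈ E′ → s ≡ e
      Path∩E′ s∈S p e∈E′ = P.disjoint s∈S e∈S p (P.start e∈S)
        where e∈S = ∉U⇒∈S e∈E′ (proj₂ (x∈p─q⁻ E U (P.within s∈S p)))

      disjoint : ∀ {t t′ e} → t ∈ T → t′ ∈ T → Branch t e → Branch t′ e → t ≡ t′
      disjoint t∈ t′∈ (inj₁ b) (inj₁ b′) = M.disjoint t∈ t′∈ b b′
      disjoint t∈ t′∈ (inj₁ b) (inj₂ (s , s∈S , b′ , p)) =
        M.disjoint t∈ t′∈ b (subst (M.Branch _) (Path∩E′ s∈S p (M.within t∈ b)) b′)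
      disjoint t∈ t′∈ (inj₂ (s , s∈S , b , p)) (inj₁ b′) =
        M.disjoint t∈ t′∈ (subst (M.Branch _) (Path∩E′ s∈S p (M.within t′∈ b′)) b) b′
      disjoint t∈ t′∈ (inj₂ (s , s∈S , b , p)) (inj₂ (s′ , s′∈S , b′ , p′)) with P.disjoint s∈S s′∈S p p′
      ... | refl = M.disjoint t∈ t′∈ b b′

      follow : ∀ {t s e} → s ∈ S → M.Branch t s → P.Path s e → Walk (Touch h) (Branch t) s e
      follow s∈S b p = walk-mono (λ q → inj₂ (_ , s∈S , b , q)) (P.connected s∈S p)

      reach-v : ∀ {t s} → s ∈ S → M.Branch t s →
        ∃[ y ] (Branch t y × Inc h v y × Walk (Touch h) (Branch t) s y)
      reach-v s∈S b with P.end s∈S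
      ... | y , y∈Y , p = y , inj₂ (_ , s∈S , b , p) , proj₂ (sieve⁻ AtV? y∈Y) , follow s∈S b p

      lift-walk : ∀ {t e f} → t ∈ T → Walk (Touch h′) (M.Branch t) e f → Walk (Touch h) (Branch t) e f
      lift-walk t∈T ε = ε
      lift-walk t∈T ((be , bf , e~f) ◅ w) with touch′⇒touch (M.within t∈T be) (M.within t∈T bf) e~f
      ... | inj₁ e~f′ = (inj₁ be , inj₁ bf , e~f′) ◅ lift-walk t∈T w
      ... | inj₂ (e∈S , f∈S) with reach-v e∈S be | reach-v f∈S bf
      ...   | y , by , vy , wy | z , bz , vz , wz =
        wy ◅◅ (by , bz , v , vy , vz) ◅ walk-reverse (touch-sym h) wz ◅◅ lift-walk t∈T w

      connected : ∀ {t e} → t ∈ T → Branch t e → Walk (Touch h) (Branch t) t e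
      connected t∈T (inj₁ b) = lift-walk t∈T (M.connected t∈T b)
      connected t∈T (inj₂ (s , s∈S , b , p)) = lift-walk t∈T (M.connected t∈T b) ◅◅ follow s∈S b p

      adjacent : ∀ {t t′} → t ∈ T → t′ ∈ T → t ≢ t′ → ∃[ e ] ∃[ e′ ] (Branch t e × Branch t′ e′ × Touch h e e′)
      adjacent t∈ t′∈ t≢t′ with M.adjacent t∈ t′∈ t≢t′
      ... | e , e′ , b , b′ , e~e′ with touch′⇒touch (M.within t∈ b) (M.within t′∈ b′) e~e′
      ...   | inj₁ touch = e , e′ , inj₁ b , inj₁ b′ , touch
      ...   | inj₂ (e∈S , e′∈S) with reach-v e∈S b | reach-v e′∈S b′
      ...     | y , by , vy , _ | z , bz , vz , _ = y , z , by , bz , v , vy , vz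

  rootedMinor :
    (∀ h′ E′ → ∣ E′ ∣ < ∣ E ∣ → Kempe h′ E′ T col → RootedMinor h′ E′ T) → RootedMinor h E T
  rootedMinor smaller with menger {E} {T} {Y} T⊆E
  ... | inj₁ P   = linked P
  ... | inj₂ Sep = lift (smaller h′ E′ E′<E contracted)
    where open Contract Sep

-- Rooted minors in line graphs of complete graphs

transpose-left : ∀ {n} (i j : Fin n) → transpose i j i ≡ j
transpose-left i j with i ≟ i
... | yes _  = refl
... | no i≢i = contradiction refl i≢i

transpose-right : ∀ {n} (i j : Fin n) → transpose i j j ≡ i
transpose-right i j with j ≟ i
... | yes j≡i = j≡i
... | no _ with j ≟ j
...   | yes _  = refl
...   | no j≢j = contradiction refl j≢j

transpose-other : ∀ {n} {i j k : Fin n} → k ≢ i → k ≢ j → transpose i j k ≡ k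
transpose-other {i = i} {j} {k} k≢i k≢j with k ≟ i
... | yes k≡i = contradiction k≡i k≢i
... | no _ with k ≟ j
...   | yes k≡j = contradiction k≡j k≢j
...   | no _    = refl

transpose-injective : ∀ {n} (i j : Fin n) {k l} → transpose i j k ≡ transpose i j l → k ≡ l
transpose-injective i j eq =
  trans (sym (transpose-inverse j i)) (trans (cong (transpose j i) eq) (transpose-inverse j i))

record Derangement {m} (xs : List (Fin m)) : Set where
  field
    ρ         : Fin m → Fin m
    closed    : ∀ {x} → x List.∈ xs → ρ x List.∈ xs
    moves     : ∀ {x} → x List.∈ xs → ρ x ≢ x
    outer     : ∀ {x} → ¬ (x List.∈ xs) → ρ x ≡ x
    injective : ∀ {x y} → ρ x ≡ ρ y → x ≡ y

-- Composing with the transposition inserts `x` into the cycle of `y`: now `y` goes to `x`, and `x`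
-- to the former image of `y`. The recursion stops at two elements, as a single one cannot be
-- deranged.
derangement : ∀ {m} (x y : Fin m) zs → Unique (x ∷ y ∷ zs) → Derangement (x ∷ y ∷ zs)
derangement x y [] ((x≢y All.∷ _) ∷ _) = record
  { ρ = transpose x y
  ; closed = λ { (here refl) → there (here (transpose-left x y))
               ; (there (here refl)) → here (transpose-right x y) }
  ; moves = λ { (here refl) eq → x≢y (trans (sym eq) (transpose-left x y))
              ; (there (here refl)) eq → x≢y (trans (sym (transpose-right x y)) eq) }
  ; outer = λ z∉ → transpose-other (λ eq → z∉ (here eq)) (λ eq → z∉ (there (here eq)))
  ; injective = transpose-injective x y
  }
derangement x y (z ∷ zs) (x# ∷ uniq) = record
  { ρ = ρ′
  ; closed = closed′
  ; moves = moves′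
  ; outer = λ w∉ → trans (cong ρ (transpose-other (λ eq → w∉ (here eq)) (λ eq → w∉ (there (here eq))))) (outer (λ w∈ → w∉ (there w∈)))
  ; injective = transpose-injective x y ∘ injective
  }
  where
  open Derangement (derangement y z zs uniq)

  ρ′ = ρ ∘ transpose x y

  x∉ : ¬ (x List.∈ y ∷ z ∷ zs)
  x∉ x∈ = All.lookup x# x∈ refl

  ρ′x : ρ′ x ≡ ρ y
  ρ′x = cong ρ (transpose-left x y)

  ρ′y : ρ′ y ≡ x
  ρ′y = trans (cong ρ (transpose-right x y)) (outer x∉)

  closed′ : ∀ {w} → w List.∈ x ∷ y ∷ z ∷ zs → ρ′ w List.∈ x ∷ y ∷ z ∷ zs
  closed′ (here refl) = there (subst (List._∈ y ∷ z ∷ zs) (sym ρ′x) (closed (here refl)))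
  closed′ {w} (there w∈) with w ≟ y
  ... | yes refl = here ρ′y
  ... | no w≢y   = there (subst (List._∈ y ∷ z ∷ zs)
      (cong ρ (sym (transpose-other (λ w≡x → x∉ (subst (List._∈ y ∷ z ∷ zs) w≡x w∈)) w≢y))) (closed w∈))

  moves′ : ∀ {w} → w List.∈ x ∷ y ∷ z ∷ zs → ρ′ w ≢ w
  moves′ (here refl) eq =
    x∉ (subst (List._∈ y ∷ z ∷ zs) (trans (sym ρ′x) eq) (closed (here refl)))
  moves′ {w} (there w∈) eq with w ≟ y
  ... | yes refl = x∉ (here (trans (sym ρ′y) eq))
  ... | no w≢y   = moves w∈
      (trans (cong ρ (sym (transpose-other (λ w≡x → x∉ (subst (List._∈ y ∷ z ∷ zs) w≡x w∈)) w≢y))) eq)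

module _ {n m} (h : Ends n m) where

  third-end : ∀ {e x y z} → Inc h x e → Inc h y e → Inc h z e → x ≢ y → z ≢ x → z ≡ y
  third-end (inj₁ refl) (inj₁ refl) _           x≢y _   = contradiction refl x≢y
  third-end (inj₂ refl) (inj₂ refl) _           x≢y _   = contradiction refl x≢y
  third-end (inj₁ refl) (inj₂ refl) (inj₁ refl) _   z≢x = contradiction refl z≢x
  third-end (inj₁ refl) (inj₂ refl) (inj₂ refl) _   _   = refl
  third-end (inj₂ refl) (inj₁ refl) (inj₁ refl) _   _   = refl
  third-end (inj₂ refl) (inj₁ refl) (inj₂ refl) _   z≢x = contradiction refl z≢x

  other-end : ∀ {e x} → proj₁ (h e) ≢ proj₂ (h e) → Inc h x e → ∃[ y ] (y ≢ x × Inc h y e)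
  other-end e-loopless (inj₁ refl) = _ , (λ eq → e-loopless (sym eq)) , inj₂ refl
  other-end e-loopless (inj₂ refl) = _ , e-loopless , inj₁ refl

module CompleteGraph {n m} {h : Ends n m} {E T : Subset m} (T⊆E : T ⊆ E)
  (loopless : ∀ {e} → e ∈ E → proj₁ (h e) ≢ proj₂ (h e))
  (simple : ∀ {e f x y} → e ∈ E → f ∈ E → x ≢ y →
    Inc h x e → Inc h y e → Inc h x f → Inc h y f → e ≡ f)
  (complete : ∀ {x y} → x ≢ y → ∃[ e ] (e ∈ E × Inc h x e) → ∃[ e ] (e ∈ E × Inc h y e) →
    ∃[ e ] (e ∈ E × Inc h x e × Inc h y e)) where

  Covered : Pred (Fin n) 0ℓ
  Covered x = ∃[ e ] (e ∈ E × Inc h x e)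

  record Centring (κ : Fin m → Fin n) : Set where
    field
      covered   : ∀ {t} → t ∈ T → Covered (κ t)
      injective : ∀ {t u} → t ∈ T → u ∈ T → κ t ≡ κ u → t ≡ u

  transposed : ∀ {κ} → Centring κ → ∀ {x y} → Covered x → Covered y → Centring (transpose x y ∘ κ)
  transposed {κ} c {x} {y} cx cy = record
    { covered = λ {t} t∈T → covered′ t∈T
    ; injective = λ t∈ u∈ → injective t∈ u∈ ∘ transpose-injective x y
    }
    where
    open Centring c
    covered′ : ∀ {t} → t ∈ T → Covered (transpose x y (κ t))
    covered′ {t} t∈T with κ t ≟ x
    ... | yes _ = cy
    ... | no _ with κ t ≟ y
    ...   | yes _ = cx
    ...   | no _  = covered t∈T

  -- Each t in T takes the edges outside T from its centre κ t to those vertices p with O (κ t) p,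
  -- where the tournament O follows F where F decides.
  module Assembly {κ} (c : Centring κ) {F : Rel (Fin n) 0ℓ} (F? : Decidable F)
    (F-asym : ∀ {x y} → x ≢ y → F x y → ¬ F y x) where
    open Centring c

    O : Rel (Fin n) 0ℓ
    O x y = F x y ⊎ (¬ F y x × x Fin.< y)

    O? : Decidable O
    O? x y = F? x y ⊎-dec (¬? (F? y x) ×-dec (x Fin.<? y))

    O-asym : ∀ {x y} → x ≢ y → O x y → ¬ O y x
    O-asym x≢y (inj₁ xy) (inj₁ yx) = F-asym x≢y xy yx
    O-asym x≢y (inj₁ xy) (inj₂ (¬xy , _)) = ¬xy xy
    O-asym x≢y (inj₂ (¬yx , _)) (inj₁ yx) = ¬yx yx
    O-asym x≢y (inj₂ (_ , x<y)) (inj₂ (_ , y<x)) = Fin.<-asym x<y y<x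

    O-total : ∀ {x y} → x ≢ y → O x y ⊎ O y x
    O-total {x} {y} x≢y with F? x y | F? y x
    ... | yes xy | _      = inj₁ (inj₁ xy)
    ... | no _   | yes yx = inj₂ (inj₁ yx)
    ... | no ¬xy | no ¬yx with x Fin.<? y
    ...   | yes x<y = inj₁ (inj₂ (¬yx , x<y))
    ...   | no x≮y  = inj₂ (inj₂ (¬xy , Fin.≤∧≢⇒< (ℕ.≮⇒≥ x≮y) (λ y≡x → x≢y (sym y≡x))))

    Owns : Rel (Fin m) 0ℓ
    Owns t e = e ∈ E × e ∉ T × Inc h (κ t) e × ∃[ p ] (Inc h p e × p ≢ κ t × O (κ t) p)

    Branch : Rel (Fin m) 0ℓ
    Branch t e = t ≡ e ⊎ Owns t e

    Branch? : Decidable Branch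
    Branch? t e = (t ≟ e) ⊎-dec ((e ∈? E) ×-dec ¬? (e ∈? T) ×-dec Inc? h (κ t) e
      ×-dec any? λ p → Inc? h p e ×-dec ¬? (p ≟ κ t) ×-dec O? (κ t) p)

    Covers : Fin m → Fin n → Set
    Covers t p = ∃[ e ] (Branch t e × Inc h p e)

    covers-end : ∀ {t p} → Inc h p t → Covers t p
    covers-end inc = _ , inj₁ refl , inc

    covers-by : ∀ {t p e} → e ∈ E → e ∉ T → Inc h (κ t) e → Inc h p e → p ≢ κ t → O (κ t) p → Covers t p
    covers-by e∈E e∉T inc inc′ p≢ o = _ , inj₂ (e∈E , e∉T , inc , _ , inc′ , p≢ , o) , inc′

    -- `link` ties a root to a centre that is not one of its ends. `conflict` treats two centres
    -- joined by an edge of `T` that is centred at neither of its ends.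
    module _
      (link : ∀ {t} → t ∈ T → ¬ Inc h (κ t) t →
        ∃[ a ] ∃[ e ] (Inc h a t × O (κ t) a × e ∈ E × e ∉ T × Inc h a e × Inc h (κ t) e))
      (conflict : ∀ {t u g} → t ∈ T → u ∈ T → g ∈ T → ¬ Inc h (κ g) g →
        Inc h (κ t) g → Inc h (κ u) g → ∃[ p ] (Covers t p × Covers u p)) where

      link-walk : ∀ {t} → t ∈ T → ∃[ e ] (Branch t e × Inc h (κ t) e × Walk (Touch h) (Branch t) t e)
      link-walk {t} t∈T with Inc? h (κ t) t
      ... | yes inc = t , inj₁ refl , inc , ε
      ... | no ¬inc with link t∈T ¬inc
      ...   | a , e , at , o , e∈E , e∉T , ae , κe = e , b , κe , (inj₁ refl , b , a , at , ae) ◅ ε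
        where b = inj₂ (e∈E , e∉T , κe , a , ae , (λ a≡κ → ¬inc (subst (λ x → Inc h x t) a≡κ at)) , o)

      -- An edge outside `T` owned twice would join the two centres, and the tournament gives it to
      -- only one of them.
      disjoint : ∀ {t u e} → t ∈ T → u ∈ T → Branch t e → Branch u e → t ≡ u
      disjoint t∈T u∈T (inj₁ refl) (inj₁ refl) = refl
      disjoint t∈T u∈T (inj₁ refl) (inj₂ (_ , t∉T , _)) = contradiction t∈T t∉T
      disjoint t∈T u∈T (inj₂ (_ , u∉T , _)) (inj₁ refl) = contradiction u∈T u∉T
      disjoint {t} {u} t∈T u∈T (inj₂ (_ , _ , κt , p , pe , p≢ , o)) (inj₂ (_ , _ , κu , q , qe , q≢ , o′)) with t ≟ u
      ... | yes t≡u = t≡u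
      ... | no t≢u  = contradiction (subst (O (κ u)) (third-end h κu κt qe (λ eq → κ≢ (sym eq)) q≢) o′)
                        (O-asym κ≢ (subst (O (κ t)) (third-end h κt κu pe κ≢ p≢) o))
        where
        κ≢ : κ t ≢ κ u
        κ≢ eq = t≢u (injective t∈T u∈T eq)

      meet : ∀ {t u p} → Covers t p → Covers u p → ∃[ e ] ∃[ f ] (Branch t e × Branch u f × Touch h e f)
      meet (e , be , pe) (f , bf , pf) = e , f , be , bf , _ , pe , pf

      centre : ∀ {t} → t ∈ T → Covers t (κ t)
      centre t∈T with link-walk t∈T
      ... | e , b , κe , _ = e , b , κe

      adjacent : ∀ {t u} → t ∈ T → u ∈ T → t ≢ u → ∃[ e ] ∃[ f ] (Branch t e × Branch u f × Touch h e f)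
      adjacent {t} {u} t∈T u∈T t≢u with complete (λ eq → t≢u (injective t∈T u∈T eq)) (covered t∈T) (covered u∈T)
      ... | f , f∈E , κt , κu with f ∈? T
      ...   | no f∉T with O-total (λ eq → t≢u (injective t∈T u∈T eq))
      ...     | inj₁ o = meet (covers-by f∈E f∉T κt κu (λ eq → t≢u (injective t∈T u∈T (sym eq))) o) (centre u∈T)
      ...     | inj₂ o = meet (centre t∈T) (covers-by f∈E f∉T κu κt (λ eq → t≢u (injective t∈T u∈T eq)) o)
      adjacent {t} {u} t∈T u∈T t≢u | f , f∈E , κt , κu | yes f∈T with Inc? h (κ f) f
      ... | no ¬inc = case conflict t∈T u∈T f∈T ¬inc κt κu of λ (p , cp , cq) → meet cp cq
      -- The centre of `f` is now `κ t` or `κ u`, so `f` is the root `t` or `u` and reaches the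
      -- other centre.
      ... | yes inc with κ f ≟ κ t
      ...   | yes eq = meet (covers-end (subst (λ e → Inc h (κ u) e) (injective f∈T t∈T eq) κu)) (centre u∈T)
      ...   | no κf≢κt = meet (centre t∈T) (covers-end (subst (λ e → Inc h (κ t) e)
                (injective f∈T u∈T (third-end h κt κu inc (λ eq → t≢u (injective t∈T u∈T eq)) κf≢κt)) κt))

      rootedMinor : RootedMinor h E T
      rootedMinor = record
        { Branch = Branch
        ; Branch? = Branch?
        ; root = λ _ → inj₁ refl
        ; within = λ { t∈T (inj₁ refl) → T⊆E t∈T ; _ (inj₂ (e∈E , _)) → e∈E }
        ; disjoint = disjoint
        ; connected = λ { _ (inj₁ refl) → ε
                        ; t∈T (inj₂ o@(_ , _ , κe , _)) → case link-walk t∈T of λ (f , b , κf , w) →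
                            w ◅◅ (b , inj₂ o , _ , κf , κe) ◅ ε }
        ; adjacent = adjacent
        }

  module _ (κ : Fin m → Fin n) where

    -- An element of `T` centred at one of its ends is thought of as an arc leaving that end.
    Tail : Pred (Fin n) 0ℓ
    Tail a = ∃[ e ] (e ∈ T × κ e ≡ a × Inc h a e)

    Tail? : Decidable₁ Tail
    Tail? a = any? λ e → (e ∈? T) ×-dec (κ e ≟ a) ×-dec Inc? h a e

    Bad : Pred (Fin m) 0ℓ
    Bad g = g ∈ T × ¬ Inc h (κ g) g

    Bad? : Decidable₁ Bad
    Bad? g = (g ∈? T) ×-dec ¬? (Inc? h (κ g) g)

    Open₀ Open₁ : Set
    Open₀ = ∃[ g ] (Bad g × ∃[ a ] (Inc h a g × ¬ Tail a))
    Open₁ = ∃[ g ] (Bad g × ∃[ a ] (Inc h a g × ∃[ e ] (e ∈ T × κ e ≡ a × Inc h a e ×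
              ∃[ b ] (Inc h b e × ¬ Tail b))))

    Open₀? : Dec Open₀
    Open₀? = any? λ g → Bad? g ×-dec any? λ a → Inc? h a g ×-dec ¬? (Tail? a)

    Open₁? : Dec Open₁
    Open₁? = any? λ g → Bad? g ×-dec any? λ a → Inc? h a g ×-dec any? λ e → (e ∈? T) ×-dec (κ e ≟ a) ×-dec
      Inc? h a e ×-dec any? λ b → Inc? h b e ×-dec ¬? (Tail? b)

    -- No alternating path of length at most two leads from an element of T whose centre is not
    -- one of its ends to a vertex that is free to become its centre.
    record Saturated : Set where
      field
        tail₀ : ∀ {g a} → Bad g → Inc h a g → Tail a
        tail₁ : ∀ {g a e b} → Bad g → Inc h a g → e ∈ T → κ e ≡ a → Inc h a e → Inc h b e → Tail b

  -- `Q` does not depend on `κ`: in an augmentation of length two the centring changes between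
  -- `shift` and `put`, but both must preserve what was good at the start.
  module Improve {κ : Fin m → Fin n} (c : Centring κ) {Q : Pred (Fin m) 0ℓ}
    (Q⊆T : ∀ {e} → Q e → e ∈ T) (keeps : ∀ {e} → Q e → Inc h (κ e) e) where
    open Centring c

    put : ∀ {g a} → g ∈ T → ¬ Q g → Inc h a g → (∀ {e} → Q e → κ e ≢ a) →
      ∃[ κ′ ] (Centring κ′ × (∀ {e} → Q e → Inc h (κ′ e) e) × Inc h (κ′ g) g)
    put {g} {a} g∈T ¬Qg ag free = transpose (κ g) a ∘ κ
      , transposed c (covered g∈T) (g , T⊆E g∈T , ag)
      , (λ {e} Qe → subst (λ x → Inc h x e) (sym (transpose-other
          (λ eq → ¬Qg (subst Q (injective (Q⊆T Qe) g∈T eq) Qe)) (free Qe))) (keeps Qe))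
      , subst (λ x → Inc h x g) (sym (transpose-left (κ g) a)) ag

    shift : ∀ {e a b} → Q e → κ e ≡ a → Inc h b e → (∀ {f} → Q f → κ f ≢ b) →
      ∃[ κ′ ] (Centring κ′ × (∀ {f} → Q f → Inc h (κ′ f) f) × (∀ {f} → Q f → κ′ f ≢ a))
    shift {e} {a} {b} Qe refl be free = κ′
      , transposed c (e , T⊆E (Q⊆T Qe) , keeps Qe) (e , T⊆E (Q⊆T Qe) , be)
      , proj₁ ∘ moved , proj₂ ∘ moved
      where
      κ′ = transpose a b ∘ κ
      moved : ∀ {f} → Q f → Inc h (κ′ f) f × κ′ f ≢ a
      moved {f} Qf with κ f ≟ a
      ... | yes κf≡a = subst (Inc h b) (injective (Q⊆T Qe) (Q⊆T Qf) (sym κf≡a)) be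
                     , λ b≡a → free Qe (sym b≡a)
      ... | no κf≢a with κ f ≟ b
      ...   | yes κf≡b = contradiction κf≡b (free Qf)
      ...   | no _     = keeps Qf , κf≢a

  -- Augmenting along an open path keeps the good elements and makes `g` good, so the number of bad
  -- elements, bounded by `k`, drops.
  saturate : ∀ k κ → Centring κ → ∣ sieve (Bad? κ) ∣ < k → ∃[ κ′ ] (Centring κ′ × Saturated κ′)
  saturate (suc k) κ c (s≤s bad≤k) = continue (Open₀? κ) (Open₁? κ)
    where
    Good : Pred (Fin m) 0ℓ
    Good e = e ∈ T × Inc h (κ e) e

    retry : ∀ {g} → Bad κ g → ∃[ κ′ ] (Centring κ′ × (∀ {e} → Good e → Inc h (κ′ e) e) × Inc h (κ′ g) g) →
      ∃[ κ′ ] (Centring κ′ × Saturated κ′)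
    retry {g} bad (κ′ , c′ , keeps , fixed) = saturate k κ′ c′ (ℕ.<-≤-trans (p⊂q⇒∣p∣<∣q∣
      ( (λ {e} e∈ → case sieve⁻ (Bad? κ′) e∈ of λ (e∈T , ¬inc) →
          sieve⁺ (Bad? κ) (e∈T , λ inc → ¬inc (keeps (e∈T , inc))))
      , g , sieve⁺ (Bad? κ) bad , λ g∈ → proj₂ (sieve⁻ (Bad? κ′) g∈) fixed)) bad≤k)

    continue : Dec (Open₀ κ) → Dec (Open₁ κ) → ∃[ κ′ ] (Centring κ′ × Saturated κ′)
    continue (yes (g , bad@(g∈T , ¬inc) , a , ag , ¬t)) _ = retry bad
      (Improve.put c {Good} proj₁ proj₂ g∈T (¬inc ∘ proj₂) ag (λ (e∈T , inc) κe≡a →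
        ¬t (_ , e∈T , κe≡a , subst (λ x → Inc h x _) κe≡a inc)))
    continue (no _) (yes (g , bad@(g∈T , ¬inc) , a , ag , e , e∈T , κe , ae , b , be , ¬t))
      with Improve.shift c {Good} proj₁ proj₂ (e∈T , subst (λ x → Inc h x e) (sym κe) ae) κe be
             (λ (f∈T , inc) κf≡b → ¬t (_ , f∈T , κf≡b , subst (λ x → Inc h x _) κf≡b inc))
    ... | κ′ , c′ , keeps , free = retry bad (Improve.put c′ {Good} proj₁ keeps g∈T (¬inc ∘ proj₂) ag free)
    continue (no ¬open₀) (no ¬open₁) = κ , c , record
      { tail₀ = λ bad ag → decidable-stable (Tail? κ _) λ ¬t → ¬open₀ (_ , bad , _ , ag , ¬t)
      ; tail₁ = λ bad ag e∈T κe ae be → decidable-stable (Tail? κ _) λ ¬t →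
          ¬open₁ (_ , bad , _ , ag , _ , e∈T , κe , ae , _ , be , ¬t)
      }

  module Saturation {κ : Fin m → Fin n} (c : Centring κ) (saturated : Saturated κ) where
    open Centring c
    open Saturated saturated

    bad-centre : ∀ {k} → Bad κ k → ¬ Tail κ (κ k)
    bad-centre (k∈T , ¬inc) (e , e∈T , κe≡κk , inc) with injective e∈T k∈T κe≡κk
    ... | refl = ¬inc inc

    -- By saturation an end of a bad element is a tail, whereas the centre of a bad element is not.
    bad-ends : ∀ {g k a} → Bad κ g → Inc h a g → Bad κ k → a ≢ κ k
    bad-ends bg ag bk refl = bad-centre bk (tail₀ bg ag)

    end⇒centre : ∀ {e x y} → e ∈ E → Inc h x e → Inc h y e → x ≢ y → e ∈ T → ¬ Bad κ e →
      κ e ≡ x ⊎ κ e ≡ y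
    end⇒centre {e} {x} {y} e∈E xe ye x≢y e∈T ¬bad with κ e ≟ x | Inc? h (κ e) e
    ... | yes eq | _ = inj₁ eq
    ... | no κe≢x | yes inc = inj₂ (third-end h xe ye inc x≢y κe≢x)
    ... | no _ | no ¬inc = contradiction (e∈T , ¬inc) ¬bad

    -- Suppose that the edge is in `T`. If it is bad or centred at `a`, saturation makes `κ k` a
    -- tail; if it is centred at `κ k`, it is `k`, which is bad.
    free-edge : ∀ {g k a} → Bad κ g → Inc h a g → Bad κ k →
      ∃[ e ] (e ∈ E × e ∉ T × Inc h a e × Inc h (κ k) e)
    free-edge {g} {k} {a} bg ag bk
      with complete (bad-ends bg ag bk) (g , T⊆E (proj₁ bg) , ag) (covered (proj₁ bk))
    ... | e , e∈E , ae , κke = e , e∈E , e∉T , ae , κke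
      where
      e∉T : e ∉ T
      e∉T e∈T with Bad? κ e
      ... | yes be = bad-centre bk (tail₀ be κke)
      ... | no ¬be with end⇒centre e∈E ae κke (bad-ends bg ag bk) e∈T ¬be
      ...   | inj₁ κe≡a = bad-centre bk (tail₁ bg ag e∈T κe≡a ae κke)
      ...   | inj₂ κe≡κk = ¬be (subst (Bad κ) (injective (proj₁ bk) e∈T (sym κe≡κk)) bk)

    none-bad : (∀ {g} → ¬ Bad κ g) → RootedMinor h E T
    none-bad ¬bad = Assembly.rootedMinor c {λ _ _ → ⊥} (λ _ _ → no id) (λ _ ())
      (λ t∈T ¬inc → contradiction (t∈T , ¬inc) ¬bad) (λ _ _ g∈T ¬inc → contradiction (g∈T , ¬inc) ¬bad)

    -- The conflict at a bad g is resolved at the centre of ρ g: both elements of T centred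
    -- at an end of g are granted the edge to it.
    module Several {g₁ g₂ gs} (D : Derangement (g₁ ∷ g₂ ∷ gs))
      (bad⇒∈ : ∀ {g} → Bad κ g → g List.∈ g₁ ∷ g₂ ∷ gs) (∈⇒bad : ∀ {g} → g List.∈ g₁ ∷ g₂ ∷ gs → Bad κ g) where
      open Derangement D using (ρ; closed; moves) renaming (injective to ρ-injective)

      ρ-bad : ∀ {g} → Bad κ g → Bad κ (ρ g)
      ρ-bad = ∈⇒bad ∘ closed ∘ bad⇒∈

      Granted : Rel (Fin n) 0ℓ
      Granted x y = ∃[ g ] (Bad κ g × Inc h x g × y ≡ κ (ρ g))

      Granted? : Decidable Granted
      Granted? x y = any? λ g → Bad? κ g ×-dec Inc? h x g ×-dec (y ≟ κ (ρ g))

      BadCentre : Pred (Fin n) 0ℓ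
      BadCentre x = ∃[ g ] (Bad κ g × κ g ≡ x)

      BadCentre? : Decidable₁ BadCentre
      BadCentre? x = any? λ g → Bad? κ g ×-dec (κ g ≟ x)

      -- Apart from the grants, a bad centre wins against the vertices that are not bad centres.
      -- This is how a bad element obtains its link.
      F : Rel (Fin n) 0ℓ
      F x y = Granted x y ⊎ (BadCentre x × ¬ BadCentre y × ¬ Granted y x)

      F? : Decidable F
      F? x y = Granted? x y ⊎-dec (BadCentre? x ×-dec ¬? (BadCentre? y) ×-dec ¬? (Granted? y x))

      bad-end : ∀ {g a} → Bad κ g → Inc h a g → ¬ BadCentre a
      bad-end bg ag (k , bk , κk≡a) = bad-ends bg ag bk (sym κk≡a)

      F-asym : ∀ {x y} → x ≢ y → F x y → ¬ F y x
      F-asym _ (inj₁ (g , bg , xg , refl)) (inj₁ (g′ , bg′ , yg′ , _)) = bad-ends bg′ yg′ (ρ-bad bg) refl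
      F-asym _ (inj₁ gr) (inj₂ (_ , _ , ¬gr)) = ¬gr gr
      F-asym _ (inj₂ (_ , _ , ¬gr)) (inj₁ gr) = ¬gr gr
      F-asym _ (inj₂ (bx , _)) (inj₂ (_ , ¬bx , _)) = ¬bx bx

      -- A grant towards `κ g` comes from the bad element that `ρ` sends to `g`. If both ends of `g`
      -- had one, that element would be parallel to `g`, hence equal to it, but `ρ` moves `g`.
      ungranted-end : ∀ {g} → Bad κ g → ∃[ a ] (Inc h a g × ¬ Granted a (κ g))
      ungranted-end {g} bg with Granted? (proj₁ (h g)) (κ g) | Granted? (proj₂ (h g)) (κ g)
      ... | no ¬gr | _ = _ , inj₁ refl , ¬gr
      ... | yes _ | no ¬gr = _ , inj₂ refl , ¬gr
      ... | yes (k , bk , ak , eq) | yes (l , bl , al , eq′) = contradiction ρg≡g (moves (bad⇒∈ bg))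
        where
        ρk≡g : ρ k ≡ g
        ρk≡g = injective (proj₁ (ρ-bad bk)) (proj₁ bg) (sym eq)

        ρl≡g : ρ l ≡ g
        ρl≡g = injective (proj₁ (ρ-bad bl)) (proj₁ bg) (sym eq′)

        k≡g : k ≡ g
        k≡g = simple (T⊆E (proj₁ bk)) (T⊆E (proj₁ bg)) (loopless (T⊆E (proj₁ bg))) ak
          (subst (Inc h _) (ρ-injective (trans ρl≡g (sym ρk≡g))) al) (inj₁ refl) (inj₂ refl)

        ρg≡g : ρ g ≡ g
        ρg≡g = trans (cong ρ (sym k≡g)) ρk≡g

      rootedMinor : RootedMinor h E T
      rootedMinor = A.rootedMinor
        (λ {t} t∈T ¬inc → let bt = t∈T , ¬inc in
          case ungranted-end bt of λ (a , at , ¬gr) → case free-edge bt at bt of λ (e , e∈E , e∉T , ae , κe) →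
            a , e , at , inj₁ (inj₂ ((t , bt , refl) , bad-end bt at , ¬gr)) , e∈E , e∉T , ae , κe)
        (λ {t} {u} {g} t∈T u∈T g∈T ¬inc κt κu → let bg = g∈T , ¬inc in
          κ (ρ g) , granted bg κt , granted bg κu)
        where
        module A = Assembly c F? F-asym
        granted : ∀ {g t} → Bad κ g → Inc h (κ t) g → A.Covers t (κ (ρ g))
        granted {g} bg κt with free-edge bg κt (ρ-bad bg)
        ... | e , e∈E , e∉T , κe , κe′ = A.covers-by e∈E e∉T κe κe′
                (λ eq → bad-ends bg κt (ρ-bad bg) (sym eq)) (inj₁ (inj₁ (g , bg , κt , refl)))

    module Single {g} (bad : Bad κ g) (unique : ∀ {k} → Bad κ k → k ≡ g) where
      z a b : Fin n
      z = κ g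
      a = proj₁ (h g)
      b = proj₂ (h g)

      g∈T = proj₁ bad
      a≢b = loopless (T⊆E g∈T)

      a≢z = bad-ends bad (inj₁ refl) bad

      tail-a = tail₀ bad (inj₁ refl)
      tail-b = tail₀ bad (inj₂ refl)
      eᵃ = proj₁ tail-a
      eᵇ = proj₁ tail-b
      eᵃ∈T = proj₁ (proj₂ tail-a)
      eᵇ∈T = proj₁ (proj₂ tail-b)
      κeᵃ = proj₁ (proj₂ (proj₂ tail-a))
      κeᵇ = proj₁ (proj₂ (proj₂ tail-b))
      a-eᵃ = proj₂ (proj₂ (proj₂ tail-a))
      b-eᵇ = proj₂ (proj₂ (proj₂ tail-b))

      centred : ∀ {t e x} → t ∈ T → e ∈ T → κ e ≡ x → κ t ≡ x → t ≡ e
      centred t∈T e∈T κe κt = injective t∈T e∈T (trans κt (sym κe))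

      -- The only conflict is between `eᵃ` and `eᵇ`, centred at the ends of `g`, and these roots
      -- already meet at `p`. The tournament favours `z`, which gives `g` its link.
      touching : Touch h eᵃ eᵇ → RootedMinor h E T
      touching (p , pa , pb) = A.rootedMinor
        (λ t∈T ¬inc → case unique (t∈T , ¬inc) of λ { refl →
          case free-edge bad (inj₁ refl) bad of λ (e , e∈E , e∉T , ae , ze) →
            a , e , inj₁ refl , inj₁ refl , e∈E , e∉T , ae , ze })
        (λ t∈T u∈T k∈T ¬inc κt κu → case unique (k∈T , ¬inc) of λ { refl → p , covers-p t∈T κt , covers-p u∈T κu })
        where
        module A = Assembly c {λ x y → x ≡ z} (λ x _ → x ≟ z) (λ x≢y x≡z y≡z → x≢y (trans x≡z (sym y≡z)))

        covers-p : ∀ {t} → t ∈ T → Inc h (κ t) g → A.Covers t p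
        covers-p t∈T (inj₁ κt) = subst (λ e → A.Covers e p) (centred eᵃ∈T t∈T κt κeᵃ) (A.covers-end pa)
        covers-p t∈T (inj₂ κt) = subst (λ e → A.Covers e p) (centred eᵇ∈T t∈T κt κeᵇ) (A.covers-end pb)

      -- Exchange the centres of g and eᵇ, so that eᵇ becomes bad. The only conflict is then between g and the element
      -- centred at the other end b′ of eᵇ, which is granted the edge from b′ to a.
      module Exchange (¬touch : ¬ Touch h eᵃ eᵇ) where
        eᵇ∈E = T⊆E eᵇ∈T
        b′-spec = other-end h (loopless eᵇ∈E) b-eᵇ
        b′ = proj₁ b′-spec
        b′≢b = proj₁ (proj₂ b′-spec)
        b′-eᵇ = proj₂ (proj₂ b′-spec)

        tail-b′ = tail₁ bad (inj₂ refl) eᵇ∈T κeᵇ b-eᵇ b′-eᵇ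
        e′ = proj₁ tail-b′
        e′∈T = proj₁ (proj₂ tail-b′)
        κe′ = proj₁ (proj₂ (proj₂ tail-b′))

        b′≢z : b′ ≢ z
        b′≢z b′≡z = bad-centre bad (subst (Tail κ) b′≡z tail-b′)

        b′≢a : b′ ≢ a
        b′≢a b′≡a = ¬touch (a , a-eᵃ , subst (λ x → Inc h x eᵇ) b′≡a b′-eᵇ)

        κ′ : Fin m → Fin n
        κ′ = transpose z b ∘ κ

        c′ : Centring κ′
        c′ = transposed c (covered g∈T) (g , T⊆E g∈T , inj₂ refl)

        κ′g : κ′ g ≡ b
        κ′g = transpose-left z b

        κ′eᵇ : κ′ eᵇ ≡ z
        κ′eᵇ = trans (cong (transpose z b) κeᵇ) (transpose-right z b)

        κ′e′ : κ′ e′ ≡ b′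
        κ′e′ = trans (cong (transpose z b) κe′) (transpose-other b′≢z b′≢b)

        bad′ : ∀ {t} → Bad κ′ t → t ≡ eᵇ
        bad′ {t} (t∈T , ¬inc) with t ≟ eᵇ | t ≟ g
        ... | yes eq | _ = eq
        ... | no _ | yes refl = contradiction (subst (λ x → Inc h x g) (sym κ′g) (inj₂ refl)) ¬inc
        ... | no t≢eᵇ | no t≢g = contradiction (unique (t∈T , λ inc → ¬inc (subst (λ x → Inc h x t)
                (sym (transpose-other (λ eq → t≢g (injective t∈T g∈T eq)) (t≢eᵇ ∘ centred t∈T eᵇ∈T κeᵇ))) inc))) t≢g

        F : Rel (Fin n) 0ℓ
        F x y = x ≡ z ⊎ (y ≢ z × x ≡ b′ × y ≡ a)

        F? : Decidable F
        F? x y = (x ≟ z) ⊎-dec (¬? (y ≟ z) ×-dec (x ≟ b′) ×-dec (y ≟ a))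

        F-asym : ∀ {x y} → x ≢ y → F x y → ¬ F y x
        F-asym x≢y (inj₁ x≡z) (inj₁ y≡z) = x≢y (trans x≡z (sym y≡z))
        F-asym x≢y (inj₁ x≡z) (inj₂ (x≢z , _)) = x≢z x≡z
        F-asym x≢y (inj₂ (y≢z , _)) (inj₁ y≡z) = y≢z y≡z
        F-asym x≢y (inj₂ (_ , x≡b′ , _)) (inj₂ (_ , _ , x≡a)) = b′≢a (trans (sym x≡b′) x≡a)

        module A = Assembly c′ F? F-asym

        -- The edge `f` from `b′` to `a` is not in `T`: it is not `g`, as `b′` is no end of `g`;
        -- centred at `a` it would be `eᵃ` and touch `eᵇ`; centred at `b′` it would be `e′`, which
        -- does not end at `a` in this case.
        e′-covers-a : A.Covers e′ a
        e′-covers-a with Inc? h a e′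
        ... | yes ae′ = A.covers-end ae′
        ... | no ¬ae′ with complete b′≢a (eᵇ , eᵇ∈E , b′-eᵇ) (g , T⊆E g∈T , inj₁ refl)
        ...   | f , f∈E , b′f , af = A.covers-by f∈E f∉T (subst (λ x → Inc h x f) (sym κ′e′) b′f) af
                  (λ eq → b′≢a (trans (sym κ′e′) (sym eq))) (inj₁ (inj₂ (a≢z , κ′e′ , refl)))
          where
          f∉T : f ∉ T
          f∉T f∈T with Bad? κ f
          ... | yes bf with unique bf
          ...   | refl = b′≢b (third-end h (inj₁ refl) (inj₂ refl) b′f a≢b b′≢a)
          f∉T f∈T | no ¬bf with end⇒centre f∈E af b′f (λ eq → b′≢a (sym eq)) f∈T ¬bf
          ... | inj₁ κf≡a = ¬touch (b′ , subst (Inc h b′) (centred f∈T eᵃ∈T κeᵃ κf≡a) b′f , b′-eᵇ)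
          ... | inj₂ κf≡b′ = ¬ae′ (subst (Inc h a) (centred f∈T e′∈T κe′ κf≡b′) af)

        at-b′ : ∀ {x} → Inc h x eᵇ → x ≢ b → x ≡ b′
        at-b′ inc x≢b = third-end h b-eᵇ b′-eᵇ inc (λ eq → b′≢b (sym eq)) x≢b

        covers-a : ∀ {t} → t ∈ T → Inc h (κ′ t) eᵇ → A.Covers t a
        covers-a {t} t∈T inc with κ′ t ≟ b
        ... | yes κt≡b = subst (λ e → A.Covers e a) (Centring.injective c′ g∈T t∈T (trans κ′g (sym κt≡b)))
                           (A.covers-end (inj₁ refl))
        ... | no κt≢b  = subst (λ e → A.Covers e a)
                           (Centring.injective c′ e′∈T t∈T (trans κ′e′ (sym (at-b′ inc κt≢b)))) e′-covers-a

        rootedMinor : RootedMinor h E T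
        rootedMinor = A.rootedMinor
          (λ t∈T ¬inc → case bad′ (t∈T , ¬inc) of λ { refl →
            case free-edge bad (inj₂ refl) bad of λ (e , e∈E , e∉T , be , ze) →
              b , e , b-eᵇ , inj₁ (inj₁ κ′eᵇ) , e∈E , e∉T , be , subst (λ x → Inc h x e) (sym κ′eᵇ) ze })
          (λ t∈T u∈T k∈T ¬inc κt κu → case bad′ (k∈T , ¬inc) of λ { refl → a , covers-a t∈T κt , covers-a u∈T κu })

      rootedMinor : RootedMinor h E T
      rootedMinor with touch? h eᵃ eᵇ
      ... | yes touch = touching touch
      ... | no ¬touch = Exchange.rootedMinor ¬touch

    rootedMinor : RootedMinor h E T
    rootedMinor = by-number (filter (Bad? κ) (allFin m)) refl
      where
      bad⇒∈ : ∀ {g} → Bad κ g → g List.∈ filter (Bad? κ) (allFin m)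
      bad⇒∈ bg = ∈-filter⁺ (Bad? κ) (∈-allFin _) bg

      ∈⇒bad : ∀ {g} → g List.∈ filter (Bad? κ) (allFin m) → Bad κ g
      ∈⇒bad g∈ = proj₂ (∈-filter⁻ (Bad? κ) {xs = allFin m} g∈)

      by-number : ∀ xs → filter (Bad? κ) (allFin m) ≡ xs → RootedMinor h E T
      by-number [] eq = none-bad λ bg → case subst (_ List.∈_) eq (bad⇒∈ bg) of λ ()
      by-number (g ∷ []) eq = Single.rootedMinor (∈⇒bad (subst (g List.∈_) (sym eq) (here refl)))
        (λ bk → case subst (_ List.∈_) eq (bad⇒∈ bk) of λ { (here k≡g) → k≡g })
      by-number (g ∷ g′ ∷ gs) eq = Several.rootedMinor
        (derangement g g′ gs (subst Unique eq (Unique.filter⁺ (Bad? κ) (Unique.allFin⁺ m))))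
        (λ bk → subst (_ List.∈_) eq (bad⇒∈ bk)) (λ k∈ → ∈⇒bad (subst (_ List.∈_) (sym eq) k∈))

  rootedMinor : ∀ κ → Centring κ → RootedMinor h E T
  rootedMinor κ c with saturate _ κ c ℕ.≤-refl
  ... | κ′ , c′ , saturated = Saturation.rootedMinor c′ saturated

-- No vertex incident with all colours

injective⇒surjective : ∀ {n} (f : Fin n → Fin n) → (∀ {x y} → f x ≡ f y → x ≡ y) → ∀ y → ∃[ x ] f x ≡ y
injective⇒surjective f inj y with any? (λ x → f x ≟ y)
... | yes hit = hit
... | no miss = contradiction
  (injection⇒∣p∣≤∣q∣ ⊤ (⊤ - y) f (λ {x} _ → x∈p∧x≢y⇒x∈p-y ∈⊤ (λ eq → miss (x , eq))) (λ _ _ → inj))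
  (ℕ.<⇒≱ (x∈p⇒∣p-x∣<∣p∣ (∈⊤ {x = y})))

module NoFullVertex {n m} {h : Ends n m} {E T : Subset m} {col : Fin m → Fin m} (K : Kempe h E T col)
  (no-full : ∀ v → ∃[ t ] (t ∈ T × (∀ {e} → e ∈ E → Inc h v e → col e ≢ t)))
  {t₁ t₂ : Fin m} (t₁∈T : t₁ ∈ T) (t₂∈T : t₂ ∈ T) (t₁≁t₂ : ¬ Touch h t₁ t₂) where

  open Kempe K

  t₁≢t₂ : t₁ ≢ t₂
  t₁≢t₂ refl = t₁≁t₂ (touch-refl h)

  Mono : Pred (Fin m) 0ℓ
  Mono t = ∀ {g} → g ∈ E → col g ≡ t → g ≡ t

  -- Follow a walk in colours `l` and `t` from `g` to `l`. Touching edges of colour `t` coincide, so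
  -- the first step to another edge leads to `l`.
  mono-touch : ∀ {l t g} → l ∈ T → Mono l → t ∈ T → l ≢ t → g ∈ E → col g ≡ t → Touch h g l
  mono-touch {l} {t} l∈T mono t∈T l≢t g∈E cg =
    go cg (kempe l∈T t∈T l≢t (g∈E , inj₂ cg) (T⊆E l∈T , inj₁ (col-fix l∈T)))
    where
    go : ∀ {g} → col g ≡ t → Walk (Touch h) (Bicoloured l t) g l → Touch h g l
    go cg ε = contradiction (trans (sym (col-fix l∈T)) cg) l≢t
    go cg (((g∈E , _) , (k∈E , inj₁ ck) , g~k) ◅ w) = subst (Touch h _) (mono k∈E ck) g~k
    go cg (((g∈E , _) , (k∈E , inj₂ ck) , (v , vg , vk)) ◅ w)
      with proper g∈E k∈E vg vk (trans cg (sym ck))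
    ... | refl = go cg w

  ¬mono-t₁ : ¬ Mono t₁
  ¬mono-t₁ mono = t₁≁t₂ (touch-sym h (mono-touch t₁∈T mono t₂∈T t₁≢t₂ (T⊆E t₂∈T) (col-fix t₂∈T)))

  module Parallel {e f x y} (e∈E : e ∈ E) (f∈E : f ∈ E) (x≢y : x ≢ y)
    (xe : Inc h x e) (ye : Inc h y e) (xf : Inc h x f) (yf : Inc h y f) (e≢f : e ≢ f) where

    ce≢cf : col e ≢ col f
    ce≢cf eq = e≢f (proper e∈E f∈E xe xf eq)

    -- At `x` and at `y` both colours are already used by `e` and `f`, so a walk in these colours
    -- cannot leave the pair. By the Kempe property each of the two classes is then a single edge.
    closed : ∀ {g k} → Walk (Touch h) (Bicoloured (col e) (col f)) g k → g ≡ e ⊎ g ≡ f → k ≡ e ⊎ k ≡ f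
    closed ε g∈ = g∈
    closed ((_ , (k∈E , ck) , v , vg , vk) ◅ w) g∈ = closed w (next ck)
      where
      v-ends : v ≡ x ⊎ v ≡ y
      v-ends with v ≟ x
      ... | yes v≡x = inj₁ v≡x
      ... | no v≢x  = inj₂ ([ (λ { refl → third-end h xe ye vg x≢y v≢x })
                            , (λ { refl → third-end h xf yf vg x≢y v≢x }) ]′ g∈)

      next : col _ ≡ col e ⊎ col _ ≡ col f → _ ≡ e ⊎ _ ≡ f
      next (inj₁ c) = inj₁ (proper k∈E e∈E vk ([ (λ { refl → xe }) , (λ { refl → ye }) ]′ v-ends) c)
      next (inj₂ c) = inj₂ (proper k∈E f∈E vk ([ (λ { refl → xf }) , (λ { refl → yf }) ]′ v-ends) c)

    class-e : ∀ {g} → g ∈ E → col g ≡ col e → g ≡ e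
    class-e g∈E cg with closed (kempe (col-∈ e∈E) (col-∈ f∈E) ce≢cf (e∈E , inj₁ refl) (g∈E , inj₁ cg)) (inj₁ refl)
    ... | inj₁ g≡e  = g≡e
    ... | inj₂ refl = contradiction (sym cg) ce≢cf

    ce≡e : col e ≡ e
    ce≡e = class-e (T⊆E (col-∈ e∈E)) (col-fix (col-∈ e∈E))

    e∈T : e ∈ T
    e∈T = subst (_∈ T) ce≡e (col-∈ e∈E)

    mono-e : Mono e
    mono-e g∈E cg = class-e g∈E (trans cg (sym ce≡e))

    -- Some colour `l` is absent at `x`. Each of its edges touches `e`, as `e` is a class by itself,
    -- and so contains `y`; hence there is just one.
    module Avoiding {x y} (x≢y : x ≢ y) (xe : Inc h x e) (ye : Inc h y e) where
      l = proj₁ (no-full x)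
      l∈T = proj₁ (proj₂ (no-full x))
      avoids = proj₂ (proj₂ (no-full x))

      e≢l : e ≢ l
      e≢l e≡l = avoids e∈E xe (trans ce≡e e≡l)

      ends-at-y : ∀ {g} → g ∈ E → col g ≡ l → Inc h y g
      ends-at-y {g} g∈E cg with mono-touch e∈T mono-e l∈T e≢l g∈E cg
      ... | v , vg , ve = subst (λ v → Inc h v g) (third-end h xe ye ve x≢y (λ { refl → avoids g∈E vg cg })) vg

      yl : Inc h y l
      yl = ends-at-y (T⊆E l∈T) (col-fix l∈T)

      mono-l : Mono l
      mono-l g∈E cg = proper g∈E (T⊆E l∈T) (ends-at-y g∈E cg) yl (trans cg (sym (col-fix l∈T)))

      ¬xl : ¬ Inc h x l
      ¬xl xl = avoids (T⊆E l∈T) xl (col-fix l∈T)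

    module X = Avoiding x≢y xe ye
    module Y = Avoiding (λ eq → x≢y (sym eq)) ye xe

    -- e, X.l and Y.l form a triangle of one-edge classes; a class that touches all three has
    -- two ends of the triangle on each of its edges, hence only one edge.
    triangle : ∃[ w ] (Inc h w X.l × Inc h w Y.l)
    triangle with mono-touch X.l∈T X.mono-l Y.l∈T (λ eq → Y.¬xl (subst (Inc h y) eq X.yl)) (T⊆E Y.l∈T) (col-fix Y.l∈T)
    ... | w , wY , wX = w , wX , wY

    w = proj₁ triangle
    wX = proj₁ (proj₂ triangle)
    wY = proj₂ (proj₂ triangle)

    meets : ∀ {l a b g} → a ≢ b → Inc h a l → Inc h b l → l ∈ T → Mono l → l ≢ t₁ → g ∈ E → col g ≡ t₁ →
      Inc h a g ⊎ Inc h b g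
    meets {a = a} {b} {g} a≢b al bl l∈T mono l≢t₁ g∈E cg with mono-touch l∈T mono t₁∈T l≢t₁ g∈E cg
    ... | v , vg , vl with v ≟ a
    ...   | yes refl = inj₁ vg
    ...   | no v≢a   = inj₂ (subst (λ v → Inc h v g) (third-end h al bl vl a≢b v≢a) vg)

    mono-t₁ : Mono t₁
    mono-t₁ {g} g∈E cg with g ≟ t₁
    ... | yes g≡t₁ = g≡t₁
    ... | no g≢t₁ = ⊥-elim (clash (xy g∈E cg) (yw g∈E cg) (xw g∈E cg)
            (xy t₁∈E ct₁) (yw t₁∈E ct₁) (xw t₁∈E ct₁))
      where
      t₁∈E = T⊆E t₁∈T
      ct₁ = col-fix t₁∈T

      not-mono : ∀ {l} → Mono l → l ≢ t₁
      not-mono mono refl = g≢t₁ (mono g∈E cg)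

      y≢w : y ≢ w
      y≢w eq = Y.¬xl (subst (λ v → Inc h v Y.l) (sym eq) wY)

      x≢w : x ≢ w
      x≢w eq = X.¬xl (subst (λ v → Inc h v X.l) (sym eq) wX)

      xy : ∀ {g} → g ∈ E → col g ≡ t₁ → Inc h x g ⊎ Inc h y g
      xy = meets x≢y xe ye e∈T mono-e (not-mono mono-e)

      yw : ∀ {g} → g ∈ E → col g ≡ t₁ → Inc h y g ⊎ Inc h w g
      yw = meets y≢w X.yl wX X.l∈T X.mono-l (not-mono X.mono-l)

      xw : ∀ {g} → g ∈ E → col g ≡ t₁ → Inc h x g ⊎ Inc h w g
      xw = meets x≢w Y.yl wY Y.l∈T Y.mono-l (not-mono Y.mono-l)

      apart : ∀ {v} → Inc h v g → ¬ Inc h v t₁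
      apart vg vt = g≢t₁ (proper g∈E t₁∈E vg vt (trans cg (sym ct₁)))

      clash : Inc h x g ⊎ Inc h y g → Inc h y g ⊎ Inc h w g → Inc h x g ⊎ Inc h w g →
        Inc h x t₁ ⊎ Inc h y t₁ → Inc h y t₁ ⊎ Inc h w t₁ → Inc h x t₁ ⊎ Inc h w t₁ → ⊥
      clash (inj₁ a) (inj₁ b) _ p _ _ = [ apart a , apart b ]′ p
      clash (inj₁ a) (inj₂ b) _ _ _ p = [ apart a , apart b ]′ p
      clash (inj₂ a) _ (inj₁ b) p _ _ = [ apart b , apart a ]′ p
      clash (inj₂ a) _ (inj₂ b) _ p _ = [ apart a , apart b ]′ p

    impossible : ⊥
    impossible = ¬mono-t₁ mono-t₁

  simple : ∀ {e f x y} → e ∈ E → f ∈ E → x ≢ y → Inc h x e → Inc h y e → Inc h x f → Inc h y f → e ≡ f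
  simple {e} {f} e∈E f∈E x≢y xe ye xf yf with e ≟ f
  ... | yes e≡f = e≡f
  ... | no e≢f  = ⊥-elim (Parallel.impossible e∈E f∈E x≢y xe ye xf yf e≢f)

  Has : Fin n → Fin m → Set
  Has v t = ∃[ e ] (e ∈ E × col e ≡ t × Inc h v e)

  Has? : Decidable Has
  Has? v t = any? λ e → (e ∈? E) ×-dec (col e ≟ t) ×-dec Inc? h v e

  abstract
    has : Fin n → Fin m → Bool
    has v t = does (Has? v t)

    has⁺ : ∀ {v t} → Has v t → has v t ≡ true
    has⁺ {v} {t} = dec-true (Has? v t)

    has⁻ : ∀ {v t} → has v t ≡ true → Has v t
    has⁻ {v} {t} eq with Has? v t
    ... | yes hv = hv

  -- For distinct colours these are the vertices of odd degree in the subgraph of both: the two ends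
  -- if it is a path, none if it is a cycle.
  Odd : Fin m → Fin m → Pred (Fin n) 0ℓ
  Odd s t v = has v s ≢ has v t

  Odd? : ∀ s t → Decidable₁ (Odd s t)
  Odd? s t v = ¬? (has v s Bool.≟ has v t)

  -- The edges of two colours s and t form a path or a cycle. Starting at an odd vertex a,
  -- P is the set of edges traversed so far, x the current vertex, last the edge leading to it.
  module Traverse {s t} (s∈T : s ∈ T) (t∈T : t ∈ T) (s≢t : s ≢ t) {a} (a-odd : Odd s t a) where

    Bi : Pred (Fin m) 0ℓ
    Bi = Bicoloured s t

    record Trail (P : Subset m) (x : Fin n) (last : Fin m) : Set where
      field
        bicoloured : ∀ {e} → e ∈ P → Bi e
        last∈P     : last ∈ P
        x-last     : Inc h x last
        only-last  : ∀ {e} → e ∈ P → Inc h x e → e ≡ last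
        closed     : ∀ {e e′ y} → e ∈ P → Inc h y e → y ≢ x → Bi e′ → Inc h y e′ → e′ ∈ P
        even       : ∀ {e y} → e ∈ P → Inc h y e → y ≢ x → y ≡ a ⊎ has y s ≡ has y t
        x≢a        : x ≢ a
        origin     : ∃[ e ] (e ∈ P × Inc h a e)

    Mate : Set
    Mate = ∃[ x ] (x ≢ a × Odd s t x × (∀ {u} → Odd s t u → u ≡ a ⊎ u ≡ x))

    bi-edge : ∀ {v} → Odd s t v → ∃[ e ] (Bi e × Inc h v e)
    bi-edge {v} odd with has v s in vs | has v t in vt
    ... | true  | _     = let (e , e∈E , ce , inc) = has⁻ vs in e , (e∈E , inj₁ ce) , inc
    ... | false | true  = let (e , e∈E , ce , inc) = has⁻ vt in e , (e∈E , inj₂ ce) , inc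
    ... | false | false = contradiction refl odd

    odd-edge-unique : ∀ {v e f} → Odd s t v → Bi e → Bi f → Inc h v e → Inc h v f → e ≡ f
    odd-edge-unique _ (e∈E , inj₁ ce) (f∈E , inj₁ cf) ve vf = proper e∈E f∈E ve vf (trans ce (sym cf))
    odd-edge-unique _ (e∈E , inj₂ ce) (f∈E , inj₂ cf) ve vf = proper e∈E f∈E ve vf (trans ce (sym cf))
    odd-edge-unique odd (e∈E , inj₁ ce) (f∈E , inj₂ cf) ve vf =
      contradiction (trans (has⁺ (_ , e∈E , ce , ve)) (sym (has⁺ (_ , f∈E , cf , vf)))) odd
    odd-edge-unique odd (e∈E , inj₂ ce) (f∈E , inj₁ cf) ve vf =
      contradiction (trans (has⁺ (_ , f∈E , cf , vf)) (sym (has⁺ (_ , e∈E , ce , ve)))) odd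

    -- At an odd `x` the only edge is `last`, so no bicoloured walk leaves `P`. Thus `P` contains
    -- all edges of the two colours, and its vertices other than `a` and `x` are even.
    finish : ∀ {P x last} → Trail P x last → Odd s t x → Mate
    finish {P} {x} {last} trail x-odd = x , x≢a , x-odd , mate
      where
      open Trail trail
      sweep : ∀ {e f} → Walk (Touch h) Bi e f → e ∈ P → f ∈ P
      sweep ε e∈P = e∈P
      sweep ((_ , bf , y , ye , yf) ◅ w) e∈P with y ≟ x
      ... | no y≢x = sweep w (closed e∈P ye y≢x bf yf)
      ... | yes refl = sweep w (subst (_∈ P) (odd-edge-unique x-odd (bicoloured last∈P) bf x-last yf) last∈P)

      mate : ∀ {u} → Odd s t u → u ≡ a ⊎ u ≡ x
      mate {u} u-odd with u ≟ x | bi-edge u-odd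
      ... | yes u≡x | _ = inj₂ u≡x
      ... | no u≢x | e , be , ue with even (sweep (kempe s∈T t∈T s≢t (bicoloured last∈P) be) last∈P) ue u≢x
      ...   | inj₁ u≡a = inj₁ u≡a
      ...   | inj₂ eq  = contradiction eq u-odd

    second-edge : ∀ {x last} → has x s ≡ has x t → Bi last → Inc h x last →
      ∃[ k ] (Bi k × Inc h x k × k ≢ last × (∀ {e} → Bi e → Inc h x e → e ≡ last ⊎ e ≡ k))
    second-edge {x} {last} eq (l∈E , inj₁ cl) xl with has⁻ (trans (sym eq) (has⁺ (last , l∈E , cl , xl)))
    ... | k , k∈E , ck , xk = k , (k∈E , inj₂ ck) , xk
      , (λ { refl → s≢t (trans (sym cl) ck) })
      , λ { (e∈E , inj₁ ce) xe → inj₁ (proper e∈E l∈E xe xl (trans ce (sym cl)))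
          ; (e∈E , inj₂ ce) xe → inj₂ (proper e∈E k∈E xe xk (trans ce (sym ck))) }
    second-edge {x} {last} eq (l∈E , inj₂ cl) xl with has⁻ (trans eq (has⁺ (last , l∈E , cl , xl)))
    ... | k , k∈E , ck , xk = k , (k∈E , inj₁ ck) , xk
      , (λ { refl → s≢t (trans (sym ck) cl) })
      , λ { (e∈E , inj₂ ce) xe → inj₁ (proper e∈E l∈E xe xl (trans ce (sym cl)))
          ; (e∈E , inj₁ ce) xe → inj₂ (proper e∈E k∈E xe xk (trans ce (sym ck))) }

    extend : ∀ {P x last} → Trail P x last → has x s ≡ has x t →
      ∃[ P′ ] ∃[ x′ ] ∃[ k ] (∣ P ∣ < ∣ P′ ∣ × Trail P′ x′ k)
    extend {P} {x} {last} trail eq with second-edge eq (Trail.bicoloured trail (Trail.last∈P trail)) (Trail.x-last trail)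
    ... | k , bk , xk , k≢last , at-x with other-end h (loopless (proj₁ bk)) xk
    ...   | x′ , x′≢x , x′k = P ∪ ⁅ k ⁆ , x′ , k
            , p⊂q⇒∣p∣<∣q∣ (p⊆p∪q ⁅ k ⁆ , k , q⊆p∪q P ⁅ k ⁆ (x∈⁅x⁆ k) , k∉P) , record
      { bicoloured = λ e∈ → [ bicoloured , (λ { refl → bk }) ]′ (split e∈)
      ; last∈P = new
      ; x-last = x′k
      ; only-last = λ e∈ x′e → [ (λ e∈P → contradiction x′e (x′-new e∈P)) , id ]′ (split e∈)
      ; closed = λ e∈ ye y≢x′ be′ ye′ → [ (λ e∈P → closed′ e∈P ye be′ ye′)
                                        , (λ { refl → at-other ye y≢x′ be′ ye′ }) ]′ (split e∈)
      ; even = λ e∈ ye y≢x′ → [ (λ e∈P → even′ e∈P ye)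
                               , (λ { refl → inj₂ (subst (λ v → has v s ≡ has v t) (sym (third-end h x′k xk ye x′≢x y≢x′)) eq) }) ]′ (split e∈)
      ; x≢a = λ { refl → let (e , e∈P , ae) = origin in x′-new e∈P ae }
      ; origin = let (e , e∈P , ae) = origin in e , old e∈P , ae
      }
      where
      open Trail trail
      old : P ⊆ P ∪ ⁅ k ⁆
      old = p⊆p∪q ⁅ k ⁆

      new : k ∈ P ∪ ⁅ k ⁆
      new = q⊆p∪q P ⁅ k ⁆ (x∈⁅x⁆ k)

      split : ∀ {e} → e ∈ P ∪ ⁅ k ⁆ → e ∈ P ⊎ e ≡ k
      split e∈ = [ inj₁ , inj₂ ∘ x∈⁅y⁆⇒x≡y k ]′ (x∈p∪q⁻ P ⁅ k ⁆ e∈)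

      k∉P : k ∉ P
      k∉P k∈P = k≢last (only-last k∈P xk)

      -- Otherwise `closed` would have put `k` into `P` already. In particular the trail never
      -- returns to `a`.
      x′-new : ∀ {e} → e ∈ P → ¬ Inc h x′ e
      x′-new e∈P x′e = k∉P (closed e∈P x′e x′≢x bk x′k)

      at-current : ∀ {e} → Bi e → Inc h x e → e ∈ P ∪ ⁅ k ⁆
      at-current be xe with at-x be xe
      ... | inj₁ refl = old last∈P
      ... | inj₂ refl = new

      at-other : ∀ {e y} → Inc h y k → y ≢ x′ → Bi e → Inc h y e → e ∈ P ∪ ⁅ k ⁆
      at-other yk y≢x′ be ye with third-end h x′k xk yk x′≢x y≢x′
      ... | refl = at-current be ye

      closed′ : ∀ {e e′ y} → e ∈ P → Inc h y e → Bi e′ → Inc h y e′ → e′ ∈ P ∪ ⁅ k ⁆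
      closed′ {y = y} e∈P ye be′ ye′ with y ≟ x
      ... | yes refl = at-current be′ ye′
      ... | no y≢x   = old (closed e∈P ye y≢x be′ ye′)

      even′ : ∀ {e y} → e ∈ P → Inc h y e → y ≡ a ⊎ has y s ≡ has y t
      even′ {y = y} e∈P ye with y ≟ x
      ... | yes refl = inj₂ eq
      ... | no y≢x   = even e∈P ye y≢x

    -- `P` grows with every step and has at most `m` elements, so `k` does not run out.
    traverse : ∀ k {P x last} → m < ∣ P ∣ + k → Trail P x last → Mate
    traverse zero {P} m<P _ = contradiction (ℕ.≤-trans (subst (m <_) (ℕ.+-identityʳ ∣ P ∣) m<P) (∣p∣≤n P)) (ℕ.<-irrefl refl)
    traverse (suc k) {P} {x} m<P+k trail with has x s Bool.≟ has x t
    ... | no x-odd = finish trail x-odd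
    ... | yes eq with extend trail eq
    ...   | P′ , _ , _ , P<P′ , trail′ = traverse k (ℕ.≤-trans m<P+k
            (ℕ.≤-trans (ℕ.≤-reflexive (ℕ.+-suc ∣ P ∣ k)) (ℕ.+-monoˡ-≤ k P<P′))) trail′

    mate : Mate
    mate with bi-edge a-odd
    ... | e , be , ae with other-end h (loopless (proj₁ be)) ae
    ...   | x , x≢a , xe = traverse (suc m) (ℕ.m≤n+m (suc m) ∣ ⁅ e ⁆ ∣) (record
      { bicoloured = λ { e∈ → subst Bi (sym (x∈⁅y⁆⇒x≡y e e∈)) be }
      ; last∈P = x∈⁅x⁆ e
      ; x-last = xe
      ; only-last = λ e∈ _ → x∈⁅y⁆⇒x≡y e e∈
      ; closed = λ e∈ ye y≢x be′ ye′ → case x∈⁅y⁆⇒x≡y e e∈ of λ { refl →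
          case third-end h xe ae ye x≢a y≢x of λ { refl →
            subst (_∈ ⁅ e ⁆) (odd-edge-unique a-odd be be′ ye ye′) (x∈⁅x⁆ e) } }
      ; even = λ e∈ ye y≢x → case x∈⁅y⁆⇒x≡y e e∈ of λ { refl → inj₁ (third-end h xe ae ye x≢a y≢x) }
      ; x≢a = x≢a
      ; origin = e , x∈⁅x⁆ e , ae
      })

  O : Fin m → Pred (Fin n) 0ℓ
  O = Odd t₁

  Covered : Pred (Fin n) 0ℓ
  Covered v = ∃[ e ] (e ∈ E × Inc h v e)

  ¬odd⇒≡ : ∀ {s t v} → ¬ Odd s t v → has v s ≡ has v t
  ¬odd⇒≡ {s} {t} {v} = decidable-stable (has v s Bool.≟ has v t)

  partner : ∀ {t v} → t ∈ T → O t v → ∃[ x ] (x ≢ v × O t x × (∀ {u} → O t u → u ≡ v ⊎ u ≡ x))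
  partner t∈T odd = Traverse.mate t₁∈T t∈T (λ { refl → odd refl }) odd

  ≤2-odd : ∀ {t t′ x y z} → t ∈ T → t′ ∈ T → x ≢ y → x ≢ z → y ≢ z →
    Odd t t′ x → Odd t t′ y → ¬ Odd t t′ z
  ≤2-odd t∈T t′∈T x≢y x≢z y≢z ox oy oz with Traverse.mate t∈T t′∈T (λ { refl → ox refl }) ox
  ... | w , _ , _ , only with only oy | only oz
  ...   | inj₁ y≡x | _        = x≢y (sym y≡x)
  ...   | inj₂ _   | inj₁ z≡x = x≢z (sym z≡x)
  ...   | inj₂ y≡w | inj₂ z≡w = y≢z (trans y≡w (sym z≡w))

  odd-difference : ∀ {t t′ v} → O t v → ¬ O t′ v → Odd t t′ v
  odd-difference o ¬o′ eq = o (trans (¬odd⇒≡ ¬o′) (sym eq))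

  odd-difference′ : ∀ {t t′ v} → ¬ O t v → O t′ v → Odd t t′ v
  odd-difference′ ¬o o′ eq = o′ (trans (¬odd⇒≡ ¬o) eq)

  -- If the two sets were disjoint, all their elements would be odd for the pair `t`, `t′`; but `u`,
  -- `x` and `u′` are three.
  odd-sets-meet : ∀ {t t′ u u′} → t ∈ T → t′ ∈ T → O t u → O t′ u′ → ∃[ v ] (O t v × O t′ v)
  odd-sets-meet {t} {t′} {u} {u′} t∈T t′∈T o o′ with partner t∈T o
  ... | x , x≢u , ox , _ with Odd? t₁ t′ u | Odd? t₁ t′ x | Odd? t₁ t u′
  ...   | yes o″ | _      | _      = u , o , o″
  ...   | no _   | yes o″ | _      = x , ox , o″
  ...   | no _   | no _   | yes o″ = u′ , o″ , o′
  ...   | no ¬u  | no ¬x  | no ¬u′ = contradiction (odd-difference′ ¬u′ o′)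
            (≤2-odd t∈T t′∈T (λ eq → x≢u (sym eq)) (λ { refl → ¬u o′ }) (λ { refl → ¬x o′ })
              (odd-difference o ¬u) (odd-difference ox ¬x))

  -- If `v` lacks colour `t₁`, take the colour of an edge at `v`; if it has `t₁`, take a colour that
  -- it lacks.
  odd-for-some : ∀ {v} → Covered v → ∃[ t ] (t ∈ T × O t v)
  odd-for-some {v} (e , e∈E , ve) with has v t₁ in eq
  ... | false = col e , col-∈ e∈E , λ eq′ → case trans eq′ (has⁺ (e , e∈E , refl , ve)) of λ ()
  ... | true with no-full v
  ...   | t , t∈T , avoids = t , t∈T , λ eq′ →
            case has⁻ (sym eq′) of λ (f , f∈E , cf , vf) → avoids f∈E vf cf

  CommonOdd : Pred (Fin n) 0ℓ
  CommonOdd c = ∀ {t u} → t ∈ T → O t u → O t c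

  -- Pairwise intersecting two-element sets covering more than three points have a common point.
  sunflower : ∀ {tᵖ p x w w′} → tᵖ ∈ T → x ≢ p → O tᵖ p → O tᵖ x → (∀ {u} → O tᵖ u → u ≡ p ⊎ u ≡ x) →
    Covered w → Covered w′ → w ≢ p → w ≢ x → w′ ≢ p → w′ ≢ x → w ≢ w′ → ∃[ c ] CommonOdd c
  sunflower {tᵖ} {p} {x} {w} {w′} tᵖ∈T x≢p op ox only cw cw′ w≢p w≢x w′≢p w′≢x w≢w′
    with odd-for-some cw | odd-for-some cw′
  ... | t , t∈T , ow | t′ , t′∈T , ow′ with odd-sets-meet tᵖ∈T t∈T op ow | odd-sets-meet tᵖ∈T t′∈T op ow′
  ...   | c , pc , oc | c′ , pc′ , oc′ = c , common
    where
    avoid : ∀ {v} → O tᵖ v → w ≢ v × w′ ≢ v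
    avoid ov = [ (λ { refl → w≢p , w′≢p }) , (λ { refl → w≢x , w′≢x }) ]′ (only ov)

    only-t : ∀ {u} → O t u → u ≡ w ⊎ u ≡ c
    only-t ou with partner t∈T ow
    ... | y , _ , _ , only-y with only-y ou | only-y oc
    ...   | inj₁ u≡w | _        = inj₁ u≡w
    ...   | inj₂ _   | inj₁ c≡w = contradiction (sym c≡w) (proj₁ (avoid pc))
    ...   | inj₂ u≡y | inj₂ c≡y = inj₂ (trans u≡y (sym c≡y))

    only-t′ : ∀ {u} → O t′ u → u ≡ w′ ⊎ u ≡ c′
    only-t′ ou with partner t′∈T ow′
    ... | y , _ , _ , only-y with only-y ou | only-y oc′
    ...   | inj₁ u≡w | _        = inj₁ u≡w
    ...   | inj₂ _   | inj₁ c≡w = contradiction (sym c≡w) (proj₂ (avoid pc′))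
    ...   | inj₂ u≡y | inj₂ c≡y = inj₂ (trans u≡y (sym c≡y))

    c≡c′ : c ≡ c′
    c≡c′ with odd-sets-meet t∈T t′∈T ow ow′
    ... | v , ov , ov′ with only-t ov | only-t′ ov′
    ...   | inj₁ v≡w | inj₁ v≡w′ = contradiction (trans (sym v≡w) v≡w′) w≢w′
    ...   | inj₁ v≡w | inj₂ v≡c′ = contradiction (trans (sym v≡w) v≡c′) (proj₁ (avoid pc′))
    ...   | inj₂ v≡c | inj₁ v≡w′ = contradiction (trans (sym v≡w′) v≡c) (proj₂ (avoid pc))
    ...   | inj₂ v≡c | inj₂ v≡c′ = trans (sym v≡c) v≡c′

    common : ∀ {s u} → s ∈ T → O s u → O s c
    -- If `c` is not odd for `s`, the set of `s` meets the pairs of `t` and `t′` in `w` and `w′`,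
    -- and the pair of `tᵖ` in a third vertex.
    common {s} s∈T ou = decidable-stable (Odd? t₁ s c) λ ¬oc →
      case odd-sets-meet tᵖ∈T s∈T op ou of λ (d , pd , od) →
      case odd-sets-meet t∈T s∈T ow ou of λ (v , tv , ov) →
      case odd-sets-meet t′∈T s∈T ow′ ou of λ (v′ , tv′ , ov′) →
      let v≡w = [ id , (λ { refl → contradiction ov ¬oc }) ]′ (only-t tv)
          v′≡w′ = [ id , (λ v′≡c′ → contradiction (subst (O s) (trans v′≡c′ (sym c≡c′)) ov′) ¬oc) ]′ (only-t′ tv′)
          osw = subst (O s) v≡w ov
          osw′ = subst (O s) v′≡w′ ov′
      in ≤2-odd t₁∈T s∈T w≢w′ (proj₁ (avoid pd)) (proj₂ (avoid pd)) osw osw′ od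

  -- The nonadjacent `t₁` and `t₂` have four distinct ends. One is `p₁`, in the pair of `t`; of the
  -- other three, at least two differ from its partner `x`.
  common-odd : ∃[ c ] CommonOdd c
  common-odd with odd-for-some (t₁ , T⊆E t₁∈T , inj₁ refl)
  ... | t , t∈T , op with partner t∈T op
  ...   | x , x≢p , ox , only = choose (x ≟ p₂) (x ≟ q₁)
    where
    p₁ = proj₁ (h t₁)
    p₂ = proj₂ (h t₁)
    q₁ = proj₁ (h t₂)
    q₂ = proj₂ (h t₂)

    cover₁ : ∀ {v} → Inc h v t₁ → Covered v
    cover₁ inc = t₁ , T⊆E t₁∈T , inc

    cover₂ : ∀ {v} → Inc h v t₂ → Covered v
    cover₂ inc = t₂ , T⊆E t₂∈T , inc

    p₂≢p₁ : p₂ ≢ p₁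
    p₂≢p₁ eq = loopless (T⊆E t₁∈T) (sym eq)

    q₁≢q₂ : q₁ ≢ q₂
    q₁≢q₂ = loopless (T⊆E t₂∈T)

    apart : ∀ {v w} → Inc h v t₁ → Inc h w t₂ → w ≢ v
    apart vt₁ wt₂ refl = t₁≁t₂ (_ , vt₁ , wt₂)

    choose : Dec (x ≡ p₂) → Dec (x ≡ q₁) → ∃[ c ] CommonOdd c
    choose (yes refl) _ = sunflower t∈T x≢p op ox only (cover₂ (inj₁ refl)) (cover₂ (inj₂ refl))
      (apart (inj₁ refl) (inj₁ refl)) (apart (inj₂ refl) (inj₁ refl))
      (apart (inj₁ refl) (inj₂ refl)) (apart (inj₂ refl) (inj₂ refl)) q₁≢q₂
    choose (no x≢p₂) (yes refl) = sunflower t∈T x≢p op ox only (cover₁ (inj₂ refl)) (cover₂ (inj₂ refl))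
      p₂≢p₁ (λ eq → x≢p₂ (sym eq)) (apart (inj₁ refl) (inj₂ refl)) (λ eq → q₁≢q₂ (sym eq))
      (λ eq → apart (inj₂ refl) (inj₂ refl) (sym eq))
    choose (no x≢p₂) (no x≢q₁) = sunflower t∈T x≢p op ox only (cover₁ (inj₂ refl)) (cover₂ (inj₁ refl))
      p₂≢p₁ (λ eq → x≢p₂ (sym eq)) (apart (inj₁ refl) (inj₁ refl)) (λ eq → x≢q₁ (sym eq))
      (λ eq → apart (inj₂ refl) (inj₁ refl) (sym eq))

  module CommonVertex {c} (common : CommonOdd c) where

    -- Up to the exceptional vertex y t, the set of vertices of colour t does not depend on t.
    W : Fin n → Bool
    W v with v ≟ c
    ... | yes _ = not (has v t₁)
    ... | no _  = has v t₁

    W-c : W c ≡ not (has c t₁)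
    W-c with c ≟ c
    ... | yes _  = refl
    ... | no c≢c = contradiction refl c≢c

    W-other : ∀ {v} → v ≢ c → W v ≡ has v t₁
    W-other {v} v≢c with v ≟ c
    ... | yes v≡c = contradiction v≡c v≢c
    ... | no _    = refl

    Exception : Fin m → Pred (Fin n) 0ℓ
    Exception t y = (∀ {v} → v ≢ y → has v t ≡ W v) × has y t ≡ not (W y)

    flipped : ∀ {t v} → O t v → has v t ≡ not (has v t₁)
    flipped odd = Bool.¬-not λ eq → odd (sym eq)

    -- `W` is the vertex set of `t₁` changed at `c`. If `t` has the same set as `t₁`, the exception
    -- is `c`; if the sets differ at `c` and `x`, it is `x`.
    exception : ∀ {t} → t ∈ T → ∃[ y ] Exception t y
    exception {t} t∈T with any? (Odd? t₁ t)
    ... | no ¬odd = c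
      , (λ v≢c → trans (sym (¬odd⇒≡ λ odd → ¬odd (_ , odd))) (sym (W-other v≢c)))
      , trans (sym (¬odd⇒≡ λ odd → ¬odd (_ , odd)))
          (trans (sym (Bool.not-involutive _)) (cong not (sym W-c)))
    ... | yes (u , ou) with common t∈T ou
    ...   | oc with partner t∈T oc
    ...     | x , x≢c , ox , only = x , usual , trans (flipped ox) (cong not (sym (W-other x≢c)))
      where
      usual : ∀ {v} → v ≢ x → has v t ≡ W v
      usual {v} v≢x with v ≟ c
      ... | yes refl = flipped oc
      ... | no v≢c   = sym (¬odd⇒≡ λ ov → [ v≢c , v≢x ]′ (only ov))

    module Exceptions {y : Fin m → Fin n} (y-exception : ∀ {t} → t ∈ T → Exception t (y t)) where

      usual : ∀ {t v} → t ∈ T → v ≢ y t → has v t ≡ W v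
      usual t∈T = proj₁ (y-exception t∈T)

      exceptional : ∀ {t} → t ∈ T → has (y t) t ≡ not (W (y t))
      exceptional t∈T = proj₂ (y-exception t∈T)

      -- The exception of `t₁` is `c`. Any other covered `v` is odd for some `t`, and as `W` agrees
      -- with `t₁` at `v`, it is the exception of that `t`.
      y-surjective : ∀ {v} → Covered v → ∃[ t ] (t ∈ T × y t ≡ v)
      y-surjective {v} cv with v ≟ c
      ... | yes refl = t₁ , t₁∈T , decidable-stable (y t₁ ≟ v) λ y≢c →
              Bool.not-¬ refl (trans (usual t₁∈T (λ c≡y → y≢c (sym c≡y))) W-c)
      ... | no v≢c with odd-for-some cv
      ...   | t , t∈T , ov = t , t∈T , decidable-stable (y t ≟ v) λ y≢v →
                ov (sym (trans (usual t∈T (λ v≡y → y≢v (sym v≡y))) (W-other v≢c)))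

      σ : Fin n → Fin m
      σ v with any? (λ t → (t ∈? T) ×-dec (y t ≟ v))
      ... | yes (t , _) = t
      ... | no _        = t₁

      σ-spec : ∀ {v} → Covered v → σ v ∈ T × y (σ v) ≡ v
      σ-spec {v} cv with any? (λ t → (t ∈? T) ×-dec (y t ≟ v))
      ... | yes (_ , spec) = spec
      ... | no ¬spec       = contradiction (y-surjective cv) ¬spec

      Covered? : Decidable₁ Covered
      Covered? v = any? λ e → (e ∈? E) ×-dec Inc? h v e

      -- A vertex w of the usual set sees, for every other u, the colour σ u; sending u to the
      -- neighbour of w along that colour permutes the other vertices.
      module Spokes {w} (Ww : W w ≡ true) where

        spoke : ∀ {u} → Covered u → u ≢ w → ∃[ e ] ∃[ v ] (e ∈ E × col e ≡ σ u × Inc h w e × v ≢ w × Inc h v e)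
        spoke cu u≢w with σ-spec cu
        ... | σ∈T , yσ with has⁻ (trans (usual σ∈T (λ w≡y → u≢w (sym (trans w≡y yσ)))) Ww)
        ...   | e , e∈E , ce , we with other-end h (loopless e∈E) we
        ...     | v , v≢w , ve = e , v , e∈E , ce , we , v≢w , ve

        next : Fin n → Fin n
        next u with Covered? u | u ≟ w
        ... | yes cu | no u≢w = proj₁ (proj₂ (spoke cu u≢w))
        ... | _      | _      = u

        data Next (u v : Fin n) : Set where
          fixed : ¬ (Covered u × u ≢ w) → u ≡ v → Next u v
          along : ∀ {e} → Covered u → u ≢ w → e ∈ E → col e ≡ σ u → Inc h w e → v ≢ w → Inc h v e → Next u v

        next-spec : ∀ u → Next u (next u)
        next-spec u with Covered? u | u ≟ w
        ... | no ¬cu | yes _   = fixed (¬cu ∘ proj₁) refl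
        ... | no ¬cu | no _    = fixed (¬cu ∘ proj₁) refl
        ... | yes _  | yes u≡w = fixed (λ (_ , u≢w) → u≢w u≡w) refl
        ... | yes cu | no u≢w =
            let (_ , _ , e∈E , ce , we , v≢w , ve) = spoke cu u≢w in along cu u≢w e∈E ce we v≢w ve

        -- Two spokes to the same neighbour are the same edge, as there are no parallel edges, and
        -- its colour determines the start through `y`.
        next-injective′ : ∀ {u u′ v} → Next u v → Next u′ v → u ≡ u′
        next-injective′ (fixed _ refl) (fixed _ refl) = refl
        next-injective′ (fixed ¬out refl) (along _ _ e∈E _ _ v≢w ve) = contradiction ((_ , e∈E , ve) , v≢w) ¬out
        next-injective′ (along _ _ e∈E _ _ v≢w ve) (fixed ¬out refl) = contradiction ((_ , e∈E , ve) , v≢w) ¬out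
        next-injective′ (along cu _ e∈E ce we v≢w ve) (along cu′ _ e∈E′ ce′ we′ _ ve′)
          with simple e∈E e∈E′ v≢w ve we ve′ we′
        ... | refl = trans (sym (proj₂ (σ-spec cu))) (trans (cong y (trans (sym ce) ce′)) (proj₂ (σ-spec cu′)))

        next-injective : ∀ {u u′} → next u ≡ next u′ → u ≡ u′
        next-injective {u} {u′} eq = next-injective′ (next-spec u) (subst (Next u′) (sym eq) (next-spec u′))

        spoke-to : ∀ {v} → Covered v → v ≢ w → ∃[ u ] ∃[ e ] (Covered u × e ∈ E × col e ≡ σ u × Inc h w e × Inc h v e)
        spoke-to {v} cv v≢w with injective⇒surjective next next-injective v
        ... | u , refl with next-spec u
        ...   | fixed ¬out u≡v = contradiction (subst (λ x → Covered x × x ≢ w) (sym u≡v) (cv , v≢w)) ¬out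
        ...   | along cu _ e∈E ce we _ ve = u , _ , cu , e∈E , ce , we , ve

        -- The edge of colour `t` at `w` is the spoke to its other end, so its colour is `σ u` for
        -- some covered `u`, and `u` is `y t`.
        y-section : ∀ {t} → t ∈ T → has w t ≡ true → Covered (y t) × t ≡ σ (y t)
        y-section t∈T wt with has⁻ wt
        ... | f , f∈E , refl , wf with other-end h (loopless f∈E) wf
        ...   | v , v≢w , vf with spoke-to (f , f∈E , vf) v≢w
        ...     | u , e , cu , e∈E , ce , we , ve with simple e∈E f∈E v≢w ve we vf wf
        ...       | refl = subst Covered u≡y cu , trans ce (cong σ u≡y)
          where
          u≡y : u ≡ y (col e)
          u≡y = trans (sym (proj₂ (σ-spec cu))) (cong y (sym ce))

      has-end : ∀ {e v} → e ∈ E → Inc h v e → has v (col e) ≡ true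
      has-end e∈E ve = has⁺ (_ , e∈E , refl , ve)

      Usual : Pred (Fin n) 0ℓ
      Usual v = Covered v × W v ≡ true

      usual-end : ∀ {t v} → t ∈ T → Inc h v t → v ≢ y t → Usual v
      usual-end t∈T vt v≢y = (_ , T⊆E t∈T , vt)
        , trans (sym (usual t∈T v≢y)) (subst (λ s → has _ s ≡ true) (col-fix t∈T) (has-end (T⊆E t∈T) vt))

      one-usual : ∃[ w ] Usual w
      one-usual with proj₁ (h t₁) ≟ y t₁
      ... | no ≢y = _ , usual-end t₁∈T (inj₁ refl) ≢y
      ... | yes ≡y = _ , usual-end t₁∈T (inj₂ refl) (λ eq → loopless (T⊆E t₁∈T) (trans ≡y (sym eq)))

      -- As `p` is in `W` and is the exception of the colour `σ p`, this colour is absent at `p`. So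
      -- neither end of the edge `σ p` is exceptional for its colour, and both are usual.
      two-usual : ∃[ w ] ∃[ w′ ] (w ≢ w′ × Usual w × Usual w′)
      two-usual with one-usual
      ... | p , cp , Wp with σ-spec cp
      ...   | σ∈T , yσ = _ , _ , loopless (T⊆E σ∈T) , end (inj₁ refl) , end (inj₂ refl)
        where
        end : ∀ {v} → Inc h v (σ p) → Usual v
        end {v} inc = usual-end σ∈T inc λ { refl →
          Bool.not-¬ refl (trans
          (sym (subst (λ s → has v s ≡ true) (col-fix σ∈T) (has-end (T⊆E σ∈T) inc)))
          (trans (exceptional σ∈T) (cong not (trans (cong W yσ) Wp)))) }

      usual≢ : ∀ v → ∃[ w ] (w ≢ v × Usual w)
      usual≢ v with two-usual
      ... | w , w′ , w≢w′ , uw , uw′ with w ≟ v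
      ...   | no w≢v   = w , w≢v , uw
      ...   | yes refl = w′ , (λ eq → w≢w′ (sym eq)) , uw′

      -- If `z` is not in `W`, every edge at `z` has a colour with exception `z`, and those from `w`
      -- and `w′` both have colour `σ z`. By properness they are one edge, with the three ends `w`,
      -- `w′` and `z`.
      all-usual : ∀ {z} → Covered z → W z ≡ true
      all-usual {z} cz with W z in Wz
      ... | true = refl
      ... | false with two-usual
      ...   | w , w′ , w≢w′ , (_ , Ww) , (_ , Ww′)
        with Spokes.spoke-to Ww cz (λ { refl → case trans (sym Wz) Ww of λ () })
           | Spokes.spoke-to Ww′ cz (λ { refl → case trans (sym Wz) Ww′ of λ () })
      ...     | _ , e , _ , e∈E , _ , we , ze | _ , e′ , _ , e′∈E , _ , we′ , ze′ =
        contradiction (third-end h we ze (subst (Inc h w′) (sym e≡e′) we′) w≢z (λ eq → w≢w′ (sym eq))) w′≢z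
        where
        w≢z : w ≢ z
        w≢z refl = case trans (sym Wz) Ww of λ ()

        w′≢z : w′ ≢ z
        w′≢z refl = case trans (sym Wz) Ww′ of λ ()

        y≡z : ∀ {e} → e ∈ E → Inc h z e → z ≡ y (col e)
        y≡z {e} e∈E ze = decidable-stable (z ≟ y (col e)) λ z≢y →
          case trans (sym (trans (usual (col-∈ e∈E) z≢y) Wz)) (has-end e∈E ze) of λ ()

        colour : ∀ {w e} → W w ≡ true → w ≢ z → e ∈ E → Inc h w e → Inc h z e → col e ≡ σ z
        colour {e = e} Ww w≢z e∈E we ze = trans (proj₂ (Spokes.y-section Ww (col-∈ e∈E) (has-end e∈E we)))
          (cong σ (sym (y≡z e∈E ze)))

        e≡e′ : e ≡ e′
        e≡e′ = proper e∈E e′∈E ze ze′ (trans (colour Ww w≢z e∈E we ze) (sym (colour Ww′ w′≢z e′∈E we′ ze′)))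

      y-section : ∀ {t} → t ∈ T → Covered (y t) × t ≡ σ (y t)
      y-section {t} t∈T with usual≢ (y t)
      ... | w , w≢y , _ , Ww = Spokes.y-section Ww t∈T (trans (usual t∈T w≢y) Ww)

      complete : ∀ {u v} → u ≢ v → Covered u → Covered v → ∃[ e ] (e ∈ E × Inc h u e × Inc h v e)
      complete u≢v cu cv with Spokes.spoke-to (all-usual cu) cv (λ eq → u≢v (sym eq))
      ... | _ , e , _ , e∈E , _ , ue , ve = e , e∈E , ue , ve

      rootedMinor : RootedMinor h E T
      rootedMinor = CompleteGraph.rootedMinor T⊆E loopless simple complete y record
        { covered = proj₁ ∘ y-section
        ; injective = λ t∈T u∈T eq → trans (proj₂ (y-section t∈T)) (trans (cong σ eq) (sym (proj₂ (y-section u∈T))))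
        }

    y : Fin m → Fin n
    y t with t ∈? T
    ... | yes t∈T = proj₁ (exception t∈T)
    ... | no _    = c

    y-exception : ∀ {t} → t ∈ T → Exception t (y t)
    y-exception {t} t∈T with t ∈? T
    ... | yes t∈T′ = proj₂ (exception t∈T′)
    ... | no t∉T   = contradiction t∈T t∉T

    rootedMinor : RootedMinor h E T
    rootedMinor = Exceptions.rootedMinor y-exception

  rootedMinor : RootedMinor h E T
  rootedMinor = CommonVertex.rootedMinor (proj₂ common-odd)

-- The induction and the translation to line graphs

solve : ∀ k {n m} (h : Ends n m) (E T : Subset m) (col : Fin m → Fin m) →
  ∣ E ∣ < k → Kempe h E T col → RootedMinor h E T
solve (suc k) {n} h E T col (s≤s E≤k) K
  with any? (λ t → any? λ u → (t ∈? T) ×-dec (u ∈? T) ×-dec ¬? (touch? h t u))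
... | no ¬apart = record
  { Branch    = _≡_
  ; Branch?   = _≟_
  ; root      = λ _ → refl
  ; within    = λ { t∈T refl → Kempe.T⊆E K t∈T }
  ; disjoint  = λ { _ _ refl refl → refl }
  ; connected = λ { _ refl → ε }
  ; adjacent  = λ {t} {u} t∈T u∈T _ → t , u , refl , refl ,
      decidable-stable (touch? h t u) λ ¬touch → ¬apart (t , u , t∈T , u∈T , ¬touch)
  }
... | yes (t₁ , t₂ , t₁∈T , t₂∈T , t₁≁t₂) = by-full-vertex (any? Full?)
  where
  Seen : Fin n → Pred (Fin _) 0ℓ
  Seen v t = ∃[ f ] (f ∈ E × col f ≡ t × Inc h v f)

  Seen? : ∀ v → Decidable₁ (Seen v)
  Seen? v t = any? λ f → (f ∈? E) ×-dec (col f ≟ t) ×-dec Inc? h v f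

  Full : Pred (Fin n) 0ℓ
  Full v = ∀ t → t ∈ T → Seen v t

  Full? : Decidable₁ Full
  Full? v = all? λ t → (t ∈? T) →-dec Seen? v t

  by-full-vertex : Dec (∃[ v ] Full v) → RootedMinor h E T
  by-full-vertex (yes (v , full)) = FullVertex.rootedMinor K (full _)
    λ h′ E′ E′<E K′ → solve k h′ E′ T col (ℕ.<-≤-trans E′<E E≤k) K′
  by-full-vertex (no ¬full) = NoFullVertex.rootedMinor K no-full t₁∈T t₂∈T t₁≁t₂
    where
    no-full : ∀ v → ∃[ t ] (t ∈ T × (∀ {e} → e ∈ E → Inc h v e → col e ≢ t))
    no-full v with any? (λ t → (t ∈? T) ×-dec ¬? (Seen? v t))
    ... | yes (t , t∈T , ¬seen) = t , t∈T , λ e∈E ve ce → ¬seen (_ , e∈E , ce , ve)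
    ... | no ¬missing = contradiction
      (v , λ t t∈T → decidable-stable (Seen? v t) λ ¬seen → ¬missing (t , t∈T , ¬seen)) ¬full

x∈⋃⁻ : ∀ {n} (𝔖 : Family n) {x} → x ∈ ⋃ 𝔖 → ∃[ A ] (A List.∈ 𝔖 × x ∈ A)
x∈⋃⁻ []      x∈ = contradiction x∈ ∉⊥
x∈⋃⁻ (A ∷ 𝔖) x∈ with x∈p∪q⁻ A (⋃ 𝔖) x∈
... | inj₁ x∈A = A , here refl , x∈A
... | inj₂ x∈′ with x∈⋃⁻ 𝔖 x∈′
...   | B , B∈ , x∈B = B , there B∈ , x∈B

x∈⋃⁺ : ∀ {n} {𝔖 : Family n} {A x} → A List.∈ 𝔖 → x ∈ A → x ∈ ⋃ 𝔖
x∈⋃⁺ {𝔖 = A ∷ 𝔖} (here refl) x∈A = p⊆p∪q (⋃ 𝔖) x∈A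
x∈⋃⁺ {𝔖 = B ∷ 𝔖} (there A∈) x∈A  = q⊆p∪q B (⋃ 𝔖) (x∈⋃⁺ A∈ x∈A)

∣p∣≡1⁻ : ∀ {n} (p : Subset n) → ∣ p ∣ ≡ 1 → ∃[ x ] (x ∈ p × (∀ {y} → y ∈ p → y ≡ x))
∣p∣≡1⁻ {n} p p≡1 with nonempty? p
... | no empty = case trans (sym p≡1) (trans (cong ∣_∣ (Empty-unique empty)) (∣⊥∣≡0 n)) of λ ()
... | yes (x , x∈p) = x , x∈p , λ {y} y∈p → decidable-stable (y ≟ x) λ y≢x →
  contradiction (ℕ.≤-trans (s≤s (ℕ.≤-trans (s≤s z≤n) (x∈p⇒∣p-x∣<∣p∣ (x∈p∧x≢y⇒x∈p-y y∈p y≢x))))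
      (ℕ.≤-trans (x∈p⇒∣p-x∣<∣p∣ x∈p) (ℕ.≤-reflexive p≡1)))
    λ { (s≤s ()) }

∣p∣≡1⁺ : ∀ {n} {p : Subset n} {x} → x ∈ p → (∀ {y} → y ∈ p → y ≡ x) → ∣ p ∣ ≡ 1
∣p∣≡1⁺ {p = p} {x} x∈p only = trans
  (cong ∣_∣ (⊆-antisym (λ y∈p → subst (_∈ ⁅ x ⁆) (sym (only y∈p)) (x∈⁅x⁆ x))
    (λ y∈ → subst (_∈ p) (sym (x∈⁅y⁆⇒x≡y x y∈)) x∈p)))
  (∣⁅x⁆∣≡1 x)

module _ (H : Graph) (ℭ : Family (Graph.size H)) (T : Subset (Graph.size H))
  (isKempe : IsKempeColoring (L H) ℭ) (isTransversal : IsTransversal T ℭ) where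

  open Graph H using (order; size; ends; loopless)
  open IsKempeColoring isKempe
  open IsColoring isColoring
  open IsPartition isPartition
  open IsTransversal isTransversal

  same-class : ∀ {A B x} → A List.∈ ℭ → B List.∈ ℭ → x ∈ A → x ∈ B → A ≡ B
  same-class {A} {B} A∈ B∈ x∈A x∈B = decidable-stable (Vec.≡-dec Bool._≟_ A B) λ A≢B →
    disjoint A∈ B∈ A≢B (_ , x∈p∩q⁺ (x∈A , x∈B))

  class : ∀ e → ∃[ A ] (A List.∈ ℭ × e ∈ A)
  class e = x∈⋃⁻ ℭ (covers e)

  representative : ∀ e → ∃[ t ] (t ∈ T ∩ proj₁ (class e) × (∀ {u} → u ∈ T ∩ proj₁ (class e) → u ≡ t))
  representative e = ∣p∣≡1⁻ _ (All.lookup meets (proj₁ (proj₂ (class e))))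

  colour : Fin size → Fin size
  colour e = proj₁ (representative e)

  colour-spec : ∀ e → colour e ∈ T × colour e ∈ proj₁ (class e)
  colour-spec e = x∈p∩q⁻ T (proj₁ (class e)) (proj₁ (proj₂ (representative e)))

  in-class : ∀ {A e} → A List.∈ ℭ → e ∈ A → A ≡ proj₁ (class e)
  in-class {e = e} A∈ e∈A = same-class A∈ (proj₁ (proj₂ (class e))) e∈A (proj₂ (proj₂ (class e)))

  same-colour⇒same-class : ∀ {e f} → colour e ≡ colour f → proj₁ (class e) ≡ proj₁ (class f)
  same-colour⇒same-class {e} {f} eq = same-class (proj₁ (proj₂ (class e))) (proj₁ (proj₂ (class f)))
    (proj₂ (colour-spec e)) (subst (_∈ proj₁ (class f)) (sym eq) (proj₂ (colour-spec f)))

  colour-unique : ∀ {A e t} → A List.∈ ℭ → e ∈ A → t ∈ T → t ∈ A → colour e ≡ t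
  colour-unique {e = e} A∈ e∈A t∈T t∈A = sym (proj₂ (proj₂ (representative e))
    (x∈p∩q⁺ (t∈T , subst (_ ∈_) (in-class A∈ e∈A) t∈A)))

  adj⇒touch : ∀ {P : Subset size} {Q : Pred (Fin size) 0ℓ} → (∀ {e} → e ∈ P → Q e) →
    ∀ {e f} → Star (InducedAdj (L H) P) e f → Walk (Touch ends) Q e f
  adj⇒touch P⊆Q = gmap id λ (e∈P , f∈P , _ , touch) → P⊆Q e∈P , P⊆Q f∈P , touch

  -- Adjacency in the line graph is irreflexive, so steps that stay at the same edge are left out.
  touch⇒adj : ∀ {P : Subset size} {Q : Pred (Fin size) 0ℓ} → (∀ {e} → Q e → e ∈ P) →
    ∀ {e f} → Walk (Touch ends) Q e f → Star (InducedAdj (L H) P) e f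
  touch⇒adj Q⊆P ε = ε
  touch⇒adj Q⊆P (_◅_ {i = e} {j = f} (qe , qf , touch) w) with e ≟ f
  ... | yes refl = touch⇒adj Q⊆P w
  ... | no e≢f   = (Q⊆P qe , Q⊆P qf , e≢f , touch) ◅ touch⇒adj Q⊆P w

  kempe-system : Kempe ends ⊤ T colour
  kempe-system = record
    { T⊆E = λ _ → ∈⊤
    ; col-∈ = λ {e} _ → proj₁ (colour-spec e)
    ; col-fix = λ {t} t∈T → colour-unique (proj₁ (proj₂ (class t))) (proj₂ (proj₂ (class t))) t∈T (proj₂ (proj₂ (class t)))
    ; loopless = λ {e} _ → loopless e
    ; proper = λ {e} {f} {v} _ _ ve vf eq → decidable-stable (e ≟ f) λ e≢f →
        All.lookup anticliques (proj₁ (proj₂ (class e))) (proj₂ (proj₂ (class e)))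
          (subst (f ∈_) (sym (same-colour⇒same-class eq)) (proj₂ (proj₂ (class f)))) (e≢f , v , ve , vf)
    ; kempe = λ {s} {t} s∈T t∈T s≢t (_ , ce) (_ , cf) →
        let (A , A∈ , s∈A) = class s
            (B , B∈ , t∈B) = class t
            A≢B = λ A≡B → s≢t (trans (sym (colour-unique A∈ s∈A s∈T s∈A))
                    (colour-unique A∈ s∈A t∈T (subst (t ∈_) (sym A≡B) t∈B)))
        in adj⇒touch
          (λ e∈ → ∈⊤ , [ (λ e∈A → inj₁ (colour-unique A∈ e∈A s∈T s∈A))
                       , (λ e∈B → inj₂ (colour-unique B∈ e∈B t∈T t∈B)) ]′ (x∈p∪q⁻ A B e∈))
          (kempe A∈ B∈ A≢B (bicoloured s∈T t∈T ce) (bicoloured s∈T t∈T cf))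
    }
    where
    own-class : ∀ {e s} → s ∈ T → colour e ≡ s → e ∈ proj₁ (class s)
    own-class {e} s∈T refl = subst (e ∈_) (in-class (proj₁ (proj₂ (class e))) (proj₂ (colour-spec e))) (proj₂ (proj₂ (class e)))

    bicoloured : ∀ {e s t} → s ∈ T → t ∈ T → colour e ≡ s ⊎ colour e ≡ t → e ∈ proj₁ (class s) ∪ proj₁ (class t)
    bicoloured {s = s} {t} s∈T t∈T c = x∈p∪q⁺ ([ inj₁ ∘ own-class s∈T , inj₂ ∘ own-class t∈T ]′ c)

  module FromRooted (M : RootedMinor ends ⊤ T) where
    module M = RootedMinor M

    branch : Fin size → Subset size
    branch t = sieve (M.Branch? t)

    branch⁺ : ∀ {t e} → M.Branch t e → e ∈ branch t
    branch⁺ {t} = sieve⁺ (M.Branch? t)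

    branch⁻ : ∀ {t e} → e ∈ branch t → M.Branch t e
    branch⁻ {t} = sieve⁻ (M.Branch? t)

    𝔎 : Family size
    𝔎 = map branch (filter (_∈? T) (allFin size))

    ∈𝔎⁺ : ∀ {t} → t ∈ T → branch t List.∈ 𝔎
    ∈𝔎⁺ t∈T = ∈-map⁺ branch (∈-filter⁺ (_∈? T) (∈-allFin _) t∈T)

    ∈𝔎⁻ : ∀ {A} → A List.∈ 𝔎 → ∃[ t ] (t ∈ T × A ≡ branch t)
    ∈𝔎⁻ A∈ with ∈-map⁻ branch A∈
    ... | t , t∈ , A≡ = t , proj₂ (∈-filter⁻ (_∈? T) {xs = allFin size} t∈) , A≡

    isCliqueMinor : IsCliqueMinor (L H) 𝔎
    isCliqueMinor = record
      { connected = All.tabulate λ A∈ → connected (∈𝔎⁻ A∈)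
      ; nonempty = All.tabulate λ A∈ → case ∈𝔎⁻ A∈ of λ { (t , t∈T , refl) → t , branch⁺ (M.root t∈T) }
      ; disjoint = λ A∈ B∈ A≢B → disjoint′ (∈𝔎⁻ A∈) (∈𝔎⁻ B∈) A≢B
      ; adjacent = λ A∈ B∈ A≢B → adjacent (∈𝔎⁻ A∈) (∈𝔎⁻ B∈) A≢B
      }
      where
      connected : ∀ {A} → ∃[ t ] (t ∈ T × A ≡ branch t) → Connected (L H) A
      connected (t , t∈T , refl) u∈ v∈ = touch⇒adj branch⁺
        (walk-reverse (touch-sym ends) (M.connected t∈T (branch⁻ u∈)) ◅◅ M.connected t∈T (branch⁻ v∈))

      disjoint′ : ∀ {A B} → ∃[ t ] (t ∈ T × A ≡ branch t) → ∃[ t ] (t ∈ T × B ≡ branch t) → A ≢ B → Disjoint A B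
      disjoint′ (t , t∈T , refl) (u , u∈T , refl) A≢B (e , e∈) with x∈p∩q⁻ (branch t) (branch u) e∈
      ... | et , eu = A≢B (cong branch (M.disjoint t∈T u∈T (branch⁻ et) (branch⁻ eu)))

      adjacent : ∀ {A B} → ∃[ t ] (t ∈ T × A ≡ branch t) → ∃[ t ] (t ∈ T × B ≡ branch t) → A ≢ B → Adjacent (L H) A B
      adjacent (t , t∈T , refl) (u , u∈T , refl) A≢B with M.adjacent t∈T u∈T (λ t≡u → A≢B (cong branch t≡u))
      ... | e , f , et , fu , touch = e , f , branch⁺ et , branch⁺ fu
        , (λ { refl → A≢B (cong branch (M.disjoint t∈T u∈T et fu)) }) , touch

    traversed : IsTransversal T 𝔎
    traversed = record
      { inUnion = λ t∈T → x∈⋃⁺ (∈𝔎⁺ t∈T) (branch⁺ (M.root t∈T))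
      ; meets = All.tabulate λ A∈ → case ∈𝔎⁻ A∈ of λ { (t , t∈T , refl) →
          ∣p∣≡1⁺ (x∈p∩q⁺ (t∈T , branch⁺ (M.root t∈T))) λ u∈ →
            case x∈p∩q⁻ T (branch t) u∈ of λ (u∈T , u∈b) → M.disjoint u∈T t∈T (M.root u∈T) (branch⁻ u∈b) }
      }

theorem1 : (H : Graph) (ℭ : Family (Graph.size H)) (T : Subset (Graph.size H)) →
    IsKempeColoring (L H) ℭ → IsTransversal T ℭ →
    ∃[ 𝔎 ] (IsCliqueMinor (L H) 𝔎 × IsTransversal T 𝔎)
theorem1 H ℭ T isKempe isTransversal = 𝔎 , isCliqueMinor , traversed
  where
  open FromRooted H ℭ T isKempe isTransversal
    (solve _ (Graph.ends H) ⊤ T _ ℕ.≤-refl (kempe-system H ℭ T isKempe isTransversal))
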